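{- Assume that for every integer $d\ge5$ and every real $x\ge\frac12(d+\sqrt{d+2})$ one has $-\frac{R_d(x)}{P_d(x)}\ge\frac{0.995(d-2)}{2x+d-2}$. Let $s_1,s_2$ be positive integers with $s_2>\frac12(\sqrt{8s_1+9}-1)$, and let $$d_0=\Bigl\lfloor\sqrt{4s_1^2+4s_1+(s_2+\tfrac12)^2}-s_2-\tfrac32\Bigr\rfloor,$$ and suppose $d_0\ge5$. If $$0<\tfrac{2}{d_0+1}(s_1^2+s_1)-\tfrac{d_0+2}{2}-s_2\le\frac{0.995(d_0-2)}{2s_1+d_0-2},$$ then $g(s_1,s_2)=\Bigl\lfloor 2s_1+s_2+\tfrac32-\sqrt{4s_1^2+4s_1+(s_2+\tfrac12)^2}\Bigr\rfloor+1$.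
   Context: Binomial coefficients $\binom{n}{k}$ are $0$ when $k<0$ or $k>n$. $f_{s_1,s_2}(N)=\binom{s_2}{N}\sum_i\binom{s_1}{i}\binom{s_1}{N-i}\binom{N}{i}$ for integers $N\ge0$; this function is unimodal, and $g(s_1,s_2)$ denotes the integer at which it attains its maximum (if the maximum is attained at two consecutive integers, either is accepted). For a nonnegative integer $d$, $P_d(x)=\sum_{i=0}^d\frac{(x_i)^2(x_{d-i})^2}{i!(d-i)!}$ with $x_i=x(x-1)\cdots(x-i+1)$ the falling factorial, and $R_d(x)$ is the remainder upon polynomial division of $P_{d+1}(x)$ by $P_d(x)$ (quotient $\frac{2}{d+1}x^2-\frac{2d}{d+1}x+\frac d2$). The first hypothesis is the paper's Conjecture 3.1, which is assumed, not proved. -}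

module Defs where

import Data.Nat as ℕ
open ℕ using (ℕ; zero; suc)
open import Data.Nat.Combinatorics using (_C_)
open import Data.Nat using () renaming (_! to _!ℕ)
import Data.Integer as ℤ
open ℤ using (ℤ; +_)
import Data.Rational as ℚ
open ℚ using (ℚ; 0ℚ; _+_; _*_; _-_; -_; _≤_; _<_; 1/_; ≢-nonZero)
open import Data.Rational.Properties using (_≟_)
open import Data.List using (List; map; upTo)
open import Data.Nat.ListAction using (sum)
open import Data.Product using (_×_)
open import Data.Sum using (_⊎_)
open import Relation.Nullary using (yes; no)

⟦_⟧ : ℕ → ℚ
⟦ n ⟧ = (+ n) ℚ./ 1

-- division with the convention q/0 = 0 (only ever used with nonzero denominators)
_÷₀_ : ℚ → ℚ → ℚ
p ÷₀ q with q ≟ 0ℚ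
... | yes _ = 0ℚ
... | no q≢0 = p * (1/_ q {{≢-nonZero q≢0}})
infixl 7 _÷₀_

Σ≤ : ℕ → (ℕ → ℚ) → ℚ
Σ≤ zero f = f zero
Σ≤ (suc n) f = Σ≤ n f + f (suc n)

-- f_{s1,s2}(N) = C(s2,N) * Σ_i C(s1,i) C(s1,N-i) C(N,i)
-- (terms with i > N vanish since C(N,i) = 0, terms with i < 0 vanish by convention)
f : ℕ → ℕ → ℕ → ℕ
f s₁ s₂ N = (s₂ C N) ℕ.* sum (map (λ i → (s₁ C i) ℕ.* (s₁ C (N ℕ.∸ i)) ℕ.* (N C i)) (upTo (suc N)))

IsArgMax : ℕ → ℕ → ℕ → Set
IsArgMax s₁ s₂ N = ∀ M → f s₁ s₂ M ℕ.≤ f s₁ s₂ N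

ff : ℚ → ℕ → ℚ
ff x zero = ⟦ 1 ⟧
ff x (suc i) = ff x i * (x - ⟦ i ⟧)

P : ℕ → ℚ → ℚ
P d x = Σ≤ d (λ i → (ff x i * ff x i * ff x (d ℕ.∸ i) * ff x (d ℕ.∸ i)) ÷₀ ⟦ (i !ℕ) ℕ.* ((d ℕ.∸ i) !ℕ) ⟧)

-- quotient of P_{d+1} by P_d : 2/(d+1) x^2 - 2d/(d+1) x + d/2
Quot : ℕ → ℚ → ℚ
Quot d x = (⟦ 2 ⟧ ÷₀ ⟦ suc d ⟧) * x * x - (⟦ 2 ℕ.* d ⟧ ÷₀ ⟦ suc d ⟧) * x + ⟦ d ⟧ ÷₀ ⟦ 2 ⟧

R : ℕ → ℚ → ℚ
R d x = P (suc d) x - Quot d x * P d x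

-- comparisons with square roots of nonnegative rationals M, written out
-- a ≤ √M
_≤√_ : ℚ → ℚ → Set
a ≤√ M = a ≤ 0ℚ ⊎ a * a ≤ M
_<√_ : ℚ → ℚ → Set
a <√ M = a < 0ℚ ⊎ a * a < M
√_≤_ : ℚ → ℚ → Set
√ M ≤ a = 0ℚ ≤ a × M ≤ a * a
√_<_ : ℚ → ℚ → Set
√ M < a = 0ℚ < a × M < a * a
infix 4 _≤√_ _<√_ √_≤_ √_<_

c995 : ℚ
c995 = (+ 199) ℚ./ 200

Conjecture31 : Set
Conjecture31 = ∀ (d : ℕ) (x : ℚ) → 5 ℕ.≤ d → √ (⟦ d ⟧ + ⟦ 2 ⟧) ≤ ⟦ 2 ⟧ * x - ⟦ d ⟧ →
  c995 * (⟦ d ⟧ - ⟦ 2 ⟧) ÷₀ (⟦ 2 ⟧ * x + ⟦ d ⟧ - ⟦ 2 ⟧) ≤ (- R d x) ÷₀ P d x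

Aq : ℕ → ℕ → ℚ
Aq s₁ s₂ = ⟦ 4 ⟧ * ⟦ s₁ ⟧ * ⟦ s₁ ⟧ + ⟦ 4 ⟧ * ⟦ s₁ ⟧ + (⟦ s₂ ⟧ + ½) * (⟦ s₂ ⟧ + ½)
  where ½ = (+ 1) ℚ./ 2

-- d0 = ⌊ √A - s2 - 3/2 ⌋, i.e. d0 ≤ √A - s2 - 3/2 < d0 + 1
IsD₀ : ℕ → ℕ → ℤ → Set
IsD₀ s₁ s₂ d = ((d ℚ./ 1) + ⟦ s₂ ⟧ + (+ 3) ℚ./ 2 ≤√ Aq s₁ s₂)
             × (√ Aq s₁ s₂ < (d ℚ./ 1) + ⟦ s₂ ⟧ + (+ 5) ℚ./ 2)

-- k = ⌊ 2 s1 + s2 + 3/2 - √A ⌋, i.e. k ≤ c - √A < k + 1 with c = 2 s1 + s2 + 3/2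
IsFloorK : ℕ → ℕ → ℤ → Set
IsFloorK s₁ s₂ k = (√ Aq s₁ s₂ ≤ c - (k ℚ./ 1)) × (c - (k ℚ./ 1) - ⟦ 1 ⟧ <√ Aq s₁ s₂)
  where c = ⟦ 2 ⟧ * ⟦ s₁ ⟧ + ⟦ s₂ ⟧ + (+ 3) ℚ./ 2

{-# OPTIONS --safe #-}
module Submission where

-- Put b_i = (x)_i² / i! at x = s₁, so that w_d = P_d(x) is the self-convolution of b, and
-- (i + 1) b_{i+1} = (x - i)² b_i. Reversing the sum defining f gives
-- f(N) = s₂! w_{2x-N} / (x!² (s₂ - N)!) for N ≤ min(s₂, 2x). Symmetry and the recurrence for b give
-- (d + 1) w_{d+1} = 2 Σ_i (x - i)² b_i b_{d-i}: up to the factor 2 / (d + 1), w_{d+1} / w_d is the mean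
-- of (x - i)² for the weights b_i b_{d-i}. As b is log-concave, these weights move to larger i as d
-- grows, so Chebyshev's sum inequality makes the mean decrease; hence w is log-concave and f is unimodal.
-- Thus only the neighbours of D = 2x - d₀ matter. With m = s₂ - D, f(D - 1) ≤ f(D) is
-- w_{d₀+1} ≤ (m + 1) w_{d₀}, which is what the conjecture and the upper bound on
-- E = 2(s₁² + s₁)/(d₀ + 1) - (d₀ + 2)/2 - s₂ give. The inequality f(D + 1) ≤ f(D) needs only that the
-- mean of (x - i)² is at least (x - d/2)², together with E > 0, which is D² > d₀ + 2 + 2(d₀ + 1) m.

open import Defs
import Data.Nat as ℕ
open ℕ using (ℕ; zero; suc; _!; _∸_)
import Data.Nat.Properties as ℕ
open import Data.Nat.Combinatorics using (_C_; nCk≡n!/k![n-k]!; k>n⇒nCk≡0; k![n∸k]!∣n!; [n-k]*[n-k-1]!≡[n-k]!; nCk≡nC[n∸k])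
open import Data.Nat.DivMod using (m/n*n≡m)
open import Data.Nat.ListAction using (sum)
open import Data.Nat.ListAction.Properties using (sum-++)
open import Data.Nat.Tactic.RingSolver using (solve-∀)
import Data.Integer as ℤ
import Data.Integer.Properties as ℤ
import Data.Rational as ℚ
import Data.Rational.Properties as ℚ
import Data.Rational.Unnormalised as ℚᵘ
import Data.Rational.Unnormalised.Properties as ℚᵘ
open import Data.Rational.Solver using (module +-*-Solver)
open import Data.List using (map; upTo; _∷ʳ_; [_])
open import Data.List.Properties using (map-++; upTo-∷ʳ)
open import Data.Empty using (⊥)
open import Data.Product using (Σ; _×_; _,_)
open import Data.Sum using (inj₁; inj₂)
open import Function using (_∘_)
open import Relation.Binary.Definitions using (tri<; tri≈; tri>)
open import Relation.Binary.PropositionalEquality using (_≡_; refl; sym; trans; cong; cong₂; subst; subst₂; module ≡-Reasoning)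
open import Relation.Nullary using (yes; no; contradiction)

module Naturals where
  open import Data.Nat using (_+_; _*_; _≤_; _<_; _≤?_; z≤n; s≤s; s≤s⁻¹; NonZero; >-nonZero)
  open import Data.Nat.Properties

  -- Finite sums of natural numbers.

  ∑ : ℕ → (ℕ → ℕ) → ℕ
  ∑ zero F = 0
  ∑ (suc n) F = ∑ n F + F n

  ∑-cong : ∀ n {F G} → (∀ i → i < n → F i ≡ G i) → ∑ n F ≡ ∑ n G
  ∑-cong zero e = refl
  ∑-cong (suc n) e = cong₂ _+_ (∑-cong n (λ i i<n → e i (m<n⇒m<1+n i<n))) (e n ≤-refl)

  ∑-mono : ∀ n {F G} → (∀ i → i < n → F i ≤ G i) → ∑ n F ≤ ∑ n G
  ∑-mono zero e = z≤n
  ∑-mono (suc n) e = +-mono-≤ (∑-mono n (λ i i<n → e i (m<n⇒m<1+n i<n))) (e n ≤-refl)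

  ∑-+ : ∀ n F G → ∑ n (λ i → F i + G i) ≡ ∑ n F + ∑ n G
  ∑-+ zero F G = refl
  ∑-+ (suc n) F G = trans (cong (_+ (F n + G n)) (∑-+ n F G)) (shuffle (∑ n F) (∑ n G) (F n) (G n))
    where
    shuffle : ∀ a b c d → a + b + (c + d) ≡ a + c + (b + d)
    shuffle = solve-∀

  ∑-*ˡ : ∀ n c F → ∑ n (λ i → c * F i) ≡ c * ∑ n F
  ∑-*ˡ zero c F = sym (*-zeroʳ c)
  ∑-*ˡ (suc n) c F = trans (cong (_+ c * F n) (∑-*ˡ n c F)) (sym (*-distribˡ-+ c (∑ n F) (F n)))

  ∑-head : ∀ n F → ∑ (suc n) F ≡ F 0 + ∑ n (F ∘ suc)
  ∑-head zero F = +-comm 0 (F 0)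
  ∑-head (suc n) F = trans (cong (_+ F (suc n)) (∑-head n F)) (+-assoc (F 0) _ _)

  ∑-reverse : ∀ n F → ∑ (suc n) (λ i → F (n ∸ i)) ≡ ∑ (suc n) F
  ∑-reverse zero F = refl
  ∑-reverse (suc n) F =
    trans (∑-head (suc n) (λ i → F (suc n ∸ i)))
      (trans (cong (F (suc n) +_) (∑-reverse n F)) (+-comm (F (suc n)) _))

  ∑-drop : ∀ k m F → (∀ i → m ≤ i → F i ≡ 0) → ∑ (k + m) F ≡ ∑ m F
  ∑-drop zero m F e = refl
  ∑-drop (suc k) m F e = trans (cong₂ _+_ (∑-drop k m F e) (e (k + m) (m≤n+m m k))) (+-identityʳ _)

  ∑-supported : ∀ m n F → (∀ i → m ≤ i → F i ≡ 0) → (∀ i → n ≤ i → F i ≡ 0) → ∑ m F ≡ ∑ n F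
  ∑-supported m n F em en = begin
    ∑ m F       ≡⟨ ∑-drop n m F em ⟨
    ∑ (n + m) F ≡⟨ cong (λ k → ∑ k F) (+-comm n m) ⟩
    ∑ (m + n) F ≡⟨ ∑-drop m n F en ⟩
    ∑ n F       ∎
    where open ≡-Reasoning

  sum-upTo : ∀ n F → sum (map F (upTo n)) ≡ ∑ n F
  sum-upTo zero F = refl
  sum-upTo (suc n) F = begin
    sum (map F (upTo (suc n)))        ≡⟨ cong (sum ∘ map F) (upTo-∷ʳ n) ⟨
    sum (map F (upTo n ∷ʳ n))         ≡⟨ cong sum (map-++ F (upTo n) [ n ]) ⟩
    sum (map F (upTo n) ∷ʳ F n)       ≡⟨ sum-++ (map F (upTo n)) [ F n ] ⟩
    sum (map F (upTo n)) + (F n + 0)  ≡⟨ cong₂ _+_ (sum-upTo n F) (+-identityʳ (F n)) ⟩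
    ∑ n F + F n                       ∎
    where open ≡-Reasoning

  -- Chebyshev's sum inequality for weights with monotone ratio.

  infix 8 _²
  _² : ℕ → ℕ
  n ² = n * n

  ²-mono : ∀ {m n} → m ≤ n → m ² ≤ n ²
  ²-mono m≤n = *-mono-≤ m≤n m≤n

  -- With `b = a + s` and `d = c + t` the two sides differ by `s * t`.
  rearrangement : ∀ {a b c d} → a ≤ b → c ≤ d → b * c + a * d ≤ a * c + b * d
  rearrangement {a} {b} {c} {d} a≤b c≤d =
    subst₂ (λ b d → b * c + a * d ≤ a * c + b * d) (m+[n∸m]≡n a≤b) (m+[n∸m]≡n c≤d)
      (≤-trans (m≤m+n _ ((b ∸ a) * (d ∸ c))) (≤-reflexive (expand a c (b ∸ a) (d ∸ c))))
    where
    expand : ∀ a c s t → (a + s) * c + a * (c + t) + s * t ≡ a * c + (a + s) * (c + t)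
    expand = solve-∀

  -- `ratio` says that q i / p i grows with i, cross-multiplied so that zero weights are allowed.
  module _ (g p q : ℕ → ℕ) (g-anti : ∀ i j → i < j → g j ≤ g i)
           (ratio : ∀ i j → i < j → q i * p j ≤ p i * q j) where

    -- The two sides of `chebyshev` differ by the sum over i < j of (g i - g j) (p i q j - q i p j).
    -- This is the part with j = n and i < m; n stays fixed while the induction runs on m.
    chebyshev-cross : ∀ m n → m ≤ n →
      ∑ m (λ i → g i * q i) * p n + g n * q n * ∑ m p ≤ ∑ m (λ i → g i * p i) * q n + g n * p n * ∑ m q
    chebyshev-cross zero n _ = ≤-reflexive (trans (*-zeroʳ (g n * q n)) (sym (*-zeroʳ (g n * p n))))
    chebyshev-cross (suc m) n m<n = begin
      (∑ m (λ i → g i * q i) + g m * q m) * p n + g n * q n * (∑ m p + p m)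
        ≡⟨ split (∑ m (λ i → g i * q i)) (g m) (q m) (p n) (g n) (q n) (∑ m p) (p m) ⟩
      ∑ m (λ i → g i * q i) * p n + g n * q n * ∑ m p + (g m * (q m * p n) + g n * (p m * q n))
        ≤⟨ +-mono-≤ (chebyshev-cross m n (<⇒≤ m<n)) (rearrangement (g-anti m n m<n) (ratio m n m<n)) ⟩
      ∑ m (λ i → g i * p i) * q n + g n * p n * ∑ m q + (g n * (q m * p n) + g m * (p m * q n))
        ≡⟨ merge (∑ m (λ i → g i * p i)) (g m) (q m) (p n) (g n) (q n) (∑ m q) (p m) ⟩
      (∑ m (λ i → g i * p i) + g m * p m) * q n + g n * p n * (∑ m q + q m) ∎
      where
      open ≤-Reasoning
      split : ∀ G gm qm pn gn qn P pm →
        (G + gm * qm) * pn + gn * qn * (P + pm) ≡ G * pn + gn * qn * P + (gm * (qm * pn) + gn * (pm * qn))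
      split = solve-∀
      merge : ∀ G gm qm pn gn qn Q pm →
        G * qn + gn * pn * Q + (gn * (qm * pn) + gm * (pm * qn)) ≡ (G + gm * pm) * qn + gn * pn * (Q + qm)
      merge = solve-∀

    chebyshev : ∀ n → ∑ n (λ i → g i * q i) * ∑ n p ≤ ∑ n (λ i → g i * p i) * ∑ n q
    chebyshev zero = z≤n
    chebyshev (suc n) = begin
      (∑ n (λ i → g i * q i) + g n * q n) * (∑ n p + p n)
        ≡⟨ split (∑ n (λ i → g i * q i)) (g n) (q n) (∑ n p) (p n) ⟩
      ∑ n (λ i → g i * q i) * ∑ n p + (∑ n (λ i → g i * q i) * p n + g n * q n * ∑ n p) + g n * q n * p n
        -- The diagonal term at n is common to both sides; only the cross terms with n are new.
        ≤⟨ +-monoˡ-≤ (g n * q n * p n) (+-mono-≤ (chebyshev n) (chebyshev-cross n n ≤-refl)) ⟩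
      ∑ n (λ i → g i * p i) * ∑ n q + (∑ n (λ i → g i * p i) * q n + g n * p n * ∑ n q) + g n * q n * p n
        ≡⟨ merge (∑ n (λ i → g i * p i)) (g n) (q n) (∑ n q) (p n) ⟩
      (∑ n (λ i → g i * p i) + g n * p n) * (∑ n q + q n) ∎
      where
      open ≤-Reasoning
      split : ∀ G g q P p → (G + g * q) * (P + p) ≡ G * P + (G * p + g * q * P) + g * q * p
      split = solve-∀
      merge : ∀ G g q Q p → G * Q + (G * q + g * p * Q) + g * q * p ≡ (G + g * p) * (Q + q)
      merge = solve-∀

  -- Log-concavity and the ratio of consecutive shifts.

  -- The coefficient u (d - j), extended by 0 to j > d (where d ∸ j would give u 0).
  lag : (ℕ → ℕ) → ℕ → ℕ → ℕ
  lag u d zero = u d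
  lag u zero (suc j) = 0
  lag u (suc d) (suc j) = lag u d j

  lag-≤ : ∀ u {d j} → j ≤ d → lag u d j ≡ u (d ∸ j)
  lag-≤ u z≤n = refl
  lag-≤ u (s≤s j≤d) = lag-≤ u j≤d

  lag-> : ∀ u {d j} → d < j → lag u d j ≡ 0
  lag-> u {zero} (s≤s _) = refl
  lag-> u {suc d} (s≤s d<j) = lag-> u d<j

  -- The ratio in question is u (d + 1 - j) / u (d - j), which grows with j because u is
  -- log-concave. Lowering d, i and j together reduces to i = 0, where one instance of log-concavity
  -- remains.
  lag-ratio : ∀ u → (∀ p q → p ≤ q → u p * u (suc q) ≤ u (suc p) * u q) →
    ∀ d i j → i < j → lag u (suc d) i * lag u d j ≤ lag u d i * lag u (suc d) j
  lag-ratio u lc zero i (suc j) _ = ≤-trans (≤-reflexive (*-zeroʳ (lag u 1 i))) z≤n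
  lag-ratio u lc (suc d) (suc i) (suc j) (s≤s i<j) = lag-ratio u lc d i j i<j
  lag-ratio u lc (suc d) zero (suc j) _ with j ≤? d
  ... | no j≰d = ≤-trans (≤-reflexive (trans (cong (u (2 + d) *_) (lag-> u (≰⇒> j≰d))) (*-zeroʳ (u (2 + d))))) z≤n
  ... | yes j≤d = begin
    u (2 + d) * lag u d j             ≡⟨ cong (u (2 + d) *_) (lag-≤ u j≤d) ⟩
    u (2 + d) * u (d ∸ j)             ≡⟨ *-comm (u (2 + d)) _ ⟩
    u (d ∸ j) * u (2 + d)             ≤⟨ lc (d ∸ j) (suc d) (m≤n⇒m≤1+n (m∸n≤m d j)) ⟩
    u (suc (d ∸ j)) * u (suc d)       ≡⟨ *-comm _ (u (suc d)) ⟩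
    u (suc d) * u (suc (d ∸ j))       ≡⟨ cong (λ k → u (suc d) * u k) (+-∸-assoc 1 j≤d) ⟨
    u (suc d) * u (suc d ∸ j)         ≡⟨ cong (u (suc d) *_) (lag-≤ u (m≤n⇒m≤1+n j≤d)) ⟨
    u (suc d) * lag u (suc d) j       ∎
    where open ≤-Reasoning

  -- Falling factorials and binomial coefficients.

  fall : ℕ → ℕ → ℕ
  fall x zero = 1
  fall x (suc i) = fall x i * (x ∸ i)

  fall-! : ∀ x i → i ≤ x → fall x i * (x ∸ i) ! ≡ x !
  fall-! x zero _ = +-identityʳ (x !)
  fall-! x (suc i) i<x = begin
    fall x i * (x ∸ i) * (x ∸ suc i) !   ≡⟨ *-assoc (fall x i) _ _ ⟩
    fall x i * ((x ∸ i) * (x ∸ suc i) !) ≡⟨ cong (fall x i *_) ([n-k]*[n-k-1]!≡[n-k]! i<x) ⟩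
    fall x i * (x ∸ i) !                 ≡⟨ fall-! x i (<⇒≤ i<x) ⟩
    x !                                  ∎
    where open ≡-Reasoning

  -- The last factor is truncated to 0. The true falling factorial vanishes there too, through its
  -- factor x - x, so truncation does no harm.
  fall-0 : ∀ x i → x < i → fall x i ≡ 0
  fall-0 x (suc i) (s≤s x≤i) = trans (cong (fall x i *_) (m≤n⇒m∸n≡0 x≤i)) (*-zeroʳ (fall x i))

  C-! : ∀ n k → k ≤ n → (n C k) * (k ! * (n ∸ k) !) ≡ n !
  C-! n k k≤n = trans (cong (_* (k ! * (n ∸ k) !)) (nCk≡n!/k![n-k]! k≤n)) (m/n*n≡m (k![n∸k]!∣n! k≤n))
    where instance _ = k !* (n ∸ k) !≢0

  C-fall : ∀ x i → (x C i) * i ! ≡ fall x i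
  C-fall x i with i ≤? x
  ... | no i≰x = trans (cong (_* i !) (k>n⇒nCk≡0 (≰⇒> i≰x))) (sym (fall-0 x i (≰⇒> i≰x)))
  ... | yes i≤x = *-cancelʳ-≡ _ _ ((x ∸ i) !)
    (trans (*-assoc (x C i) (i !) _) (trans (C-! x i i≤x) (sym (fall-! x i i≤x))))
    where instance _ = (x ∸ i) !≢0

  C-suc : ∀ x i → suc i * (x C suc i) ≡ (x ∸ i) * (x C i)
  C-suc x i = *-cancelʳ-≡ _ _ (i !) (begin
    suc i * (x C suc i) * i !   ≡⟨ shuffle (suc i) (x C suc i) (i !) ⟩
    (x C suc i) * suc i !       ≡⟨ C-fall x (suc i) ⟩
    fall x i * (x ∸ i)          ≡⟨ cong (_* (x ∸ i)) (C-fall x i) ⟨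
    (x C i) * i ! * (x ∸ i)     ≡⟨ shuffle′ (x C i) (i !) (x ∸ i) ⟩
    (x ∸ i) * (x C i) * i !     ∎)
    where
    open ≡-Reasoning
    instance _ = i !≢0
    shuffle : ∀ a b c → a * b * c ≡ b * (a * c)
    shuffle = solve-∀
    shuffle′ : ∀ a b c → a * b * c ≡ c * a * b
    shuffle′ = solve-∀

  -- The sequence b and its self-convolution w.

  module _ (x : ℕ) where

    -- (x)_i² / i!, so that P_d(x) is the self-convolution of b.
    b : ℕ → ℕ
    b i = (x C i) * fall x i

    b-suc : ∀ i → suc i * b (suc i) ≡ (x ∸ i) ² * b i
    b-suc i = begin
      suc i * ((x C suc i) * (fall x i * (x ∸ i)))  ≡⟨ shuffle (suc i) (x C suc i) (fall x i) (x ∸ i) ⟩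
      suc i * (x C suc i) * fall x i * (x ∸ i)      ≡⟨ cong (λ z → z * fall x i * (x ∸ i)) (C-suc x i) ⟩
      (x ∸ i) * (x C i) * fall x i * (x ∸ i)        ≡⟨ shuffle′ (x ∸ i) (x C i) (fall x i) ⟩
      (x ∸ i) ² * ((x C i) * fall x i)            ∎
      where
      open ≡-Reasoning
      shuffle : ∀ s c f r → s * (c * (f * r)) ≡ s * c * f * r
      shuffle = solve-∀
      shuffle′ : ∀ r c f → r * c * f * r ≡ r * r * (c * f)
      shuffle′ = solve-∀

    b-0 : ∀ i → x < i → b i ≡ 0
    b-0 i x<i = cong (_* fall x i) (k>n⇒nCk≡0 x<i)

    -- After multiplication by (p + 1)(q + 1), `b-suc` leaves (p + 1)(x - q)² ≤ (q + 1)(x - p)².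
    -- Allowing all p ≤ q, not only neighbours, avoids dividing by vanishing terms of b.
    b-logConcave : ∀ p q → p ≤ q → b p * b (suc q) ≤ b (suc p) * b q
    b-logConcave p q p≤q = *-cancelˡ-≤ (suc p * suc q) (begin
      suc p * suc q * (b p * b (suc q))        ≡⟨ shuffle (suc p) (suc q) (b p) (b (suc q)) ⟩
      suc p * (suc q * b (suc q)) * b p        ≡⟨ cong (λ z → suc p * z * b p) (b-suc q) ⟩
      suc p * ((x ∸ q) ² * b q) * b p        ≤⟨ *-monoˡ-≤ (b p) (*-mono-≤ (s≤s p≤q) (*-monoˡ-≤ (b q) (²-mono (∸-monoʳ-≤ x p≤q)))) ⟩
      suc q * ((x ∸ p) ² * b q) * b p        ≡⟨ shuffle′ (suc q) ((x ∸ p) ²) (b q) (b p) ⟩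
      ((x ∸ p) ² * b p) * b q * suc q        ≡⟨ cong (λ z → z * b q * suc q) (b-suc p) ⟨
      suc p * b (suc p) * b q * suc q          ≡⟨ shuffle″ (suc p) (b (suc p)) (b q) (suc q) ⟩
      suc p * suc q * (b (suc p) * b q)        ∎)
      where
      open ≤-Reasoning
      shuffle : ∀ a b c d → a * b * (c * d) ≡ a * (b * d) * c
      shuffle = solve-∀
      shuffle′ : ∀ a b c d → a * (b * c) * d ≡ b * d * c * a
      shuffle′ = solve-∀
      shuffle″ : ∀ a b c d → a * b * c * d ≡ a * d * (b * c)
      shuffle″ = solve-∀

    w : ℕ → ℕ
    w d = ∑ (suc d) (λ i → b i * b (d ∸ i))

    private
      -- `S d` over `w d` is the mean of (x - i)². Truncation in `x ∸ i` only affects i > x, where b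
      -- i = 0.
      S : ℕ → ℕ
      S d = ∑ (suc d) (λ i → (x ∸ i) ² * (b i * b (d ∸ i)))

      -- The sums for d and d + 1 have different lengths; padding with the zeros of `lag` puts them
      -- on one index range, as `chebyshev` requires.
      lag-sum : ∀ d n (h : ℕ → ℕ) → suc d ≤ n →
        ∑ n (λ i → h i * (b i * lag b d i)) ≡ ∑ (suc d) (λ i → h i * (b i * b (d ∸ i)))
      lag-sum d n h d<n = trans
        (∑-supported n (suc d) _ (λ i n≤i → vanish i (≤-trans d<n n≤i)) vanish)
        (∑-cong (suc d) (λ i i≤d → cong (λ z → h i * (b i * z)) (lag-≤ b (s≤s⁻¹ i≤d))))
        where
        vanish : ∀ i → d < i → h i * (b i * lag b d i) ≡ 0
        vanish i d<i = trans (cong (λ z → h i * (b i * z)) (lag-> b d<i))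
                         (trans (cong (h i *_) (*-zeroʳ (b i))) (*-zeroʳ (h i)))

      w-lag : ∀ d n → suc d ≤ n → ∑ n (λ i → b i * lag b d i) ≡ w d
      w-lag d n d<n = trans (∑-cong n (λ i _ → sym (+-identityʳ _)))
        (trans (lag-sum d n (λ _ → 1) d<n) (∑-cong (suc d) (λ i _ → +-identityʳ _)))

      -- The factor d + 1 is i + (d + 1 - i), whose two parts contribute equally by reversal;
      -- `b-suc` then absorbs the factor i.
      w-suc : ∀ d → suc d * w (suc d) ≡ 2 * S d
      w-suc d = begin
        suc d * w (suc d)
          ≡⟨ ∑-*ˡ (2 + d) (suc d) _ ⟨
        ∑ (2 + d) (λ i → suc d * c i)
          ≡⟨ ∑-cong (2 + d) (λ i i<2+d → split i (s≤s⁻¹ i<2+d)) ⟩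
        ∑ (2 + d) (λ i → F i + F (suc d ∸ i))
          ≡⟨ ∑-+ (2 + d) F (λ i → F (suc d ∸ i)) ⟩
        ∑ (2 + d) F + ∑ (2 + d) (λ i → F (suc d ∸ i))
          ≡⟨ cong (∑ (2 + d) F +_) (∑-reverse (suc d) F) ⟩
        ∑ (2 + d) F + ∑ (2 + d) F
          -- The term at i = 0 is zero by computation; the others shift down by one.
          ≡⟨ cong (λ z → z + z) (trans (∑-head (suc d) F) (∑-cong (suc d) (λ i _ → shift i))) ⟩
        S d + S d
          ≡⟨ cong (S d +_) (+-identityʳ (S d)) ⟨
        2 * S d ∎
        where
        open ≡-Reasoning
        c F : ℕ → ℕ
        c i = b i * b (suc d ∸ i)
        F i = i * c i
        split : ∀ i → i ≤ suc d → suc d * c i ≡ F i + F (suc d ∸ i)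
        split i i≤ = begin
          suc d * c i                             ≡⟨ cong (_* c i) (m+[n∸m]≡n i≤) ⟨
          (i + (suc d ∸ i)) * c i                 ≡⟨ *-distribʳ-+ (c i) i (suc d ∸ i) ⟩
          F i + (suc d ∸ i) * (b i * b (suc d ∸ i)) ≡⟨ cong (λ z → F i + (suc d ∸ i) * z) (*-comm (b i) (b (suc d ∸ i))) ⟩
          F i + (suc d ∸ i) * (b (suc d ∸ i) * b i) ≡⟨ cong (λ k → F i + (suc d ∸ i) * (b (suc d ∸ i) * b k)) (m∸[m∸n]≡n i≤) ⟨
          F i + F (suc d ∸ i)                     ∎
        shift : ∀ i → F (suc i) ≡ (x ∸ i) ² * (b i * b (d ∸ i))
        shift i = trans (sym (*-assoc (suc i) (b (suc i)) _))
                    (trans (cong (_* b (d ∸ i)) (b-suc i)) (*-assoc ((x ∸ i) ²) (b i) _))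

      -- Passing from d to d + 1 moves weight to larger i (`lag-ratio`), where (x - i)² is smaller,
      -- so the mean drops.
      S-ratio : ∀ d → S (suc d) * w d ≤ S d * w (suc d)
      S-ratio d = begin
        S (suc d) * w d
          ≡⟨ cong₂ _*_ (lag-sum (suc d) (2 + d) (λ i → (x ∸ i) ²) ≤-refl) (w-lag d (2 + d) (n≤1+n _)) ⟨
        ∑ (2 + d) (λ i → (x ∸ i) ² * q i) * ∑ (2 + d) p
          ≤⟨ chebyshev (λ i → (x ∸ i) ²) p q (λ i j i<j → ²-mono (∸-monoʳ-≤ x (<⇒≤ i<j))) ratio (2 + d) ⟩
        ∑ (2 + d) (λ i → (x ∸ i) ² * p i) * ∑ (2 + d) q
          ≡⟨ cong₂ _*_ (lag-sum d (2 + d) (λ i → (x ∸ i) ²) (n≤1+n _)) (w-lag (suc d) (2 + d) ≤-refl) ⟩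
        S d * w (suc d) ∎
        where
        open ≤-Reasoning
        p q : ℕ → ℕ
        p i = b i * lag b d i
        q i = b i * lag b (suc d) i
        swap : ∀ a b c d → a * b * (c * d) ≡ a * c * (b * d)
        swap = solve-∀
        ratio : ∀ i j → i < j → q i * p j ≤ p i * q j
        ratio i j i<j = subst₂ _≤_ (swap (b i) (b j) _ _) (swap (b i) (b j) _ _)
          (*-monoʳ-≤ (b i * b j) (lag-ratio b b-logConcave d i j i<j))

    -- By `w-suc`, (d + 1) w (d + 1) / w d is twice the mean, which decreases by `S-ratio`. The
    -- extra factor (d + 2) / (d + 1) gained this way is given up in the last step.
    w-logConcave : ∀ d → w (2 + d) * w d ≤ w (1 + d) * w (1 + d)
    w-logConcave d = *-cancelˡ-≤ (2 + d) (begin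
      (2 + d) * (w (2 + d) * w d)        ≡⟨ *-assoc (2 + d) (w (2 + d)) (w d) ⟨
      (2 + d) * w (2 + d) * w d          ≡⟨ cong (_* w d) (w-suc (suc d)) ⟩
      2 * S (suc d) * w d                ≡⟨ *-assoc 2 (S (suc d)) (w d) ⟩
      2 * (S (suc d) * w d)              ≤⟨ *-monoʳ-≤ 2 (S-ratio d) ⟩
      2 * (S d * w (1 + d))              ≡⟨ *-assoc 2 (S d) (w (1 + d)) ⟨
      2 * S d * w (1 + d)                ≡⟨ cong (_* w (1 + d)) (w-suc d) ⟨
      (1 + d) * w (1 + d) * w (1 + d)    ≡⟨ *-assoc (1 + d) (w (1 + d)) _ ⟩
      (1 + d) * (w (1 + d) * w (1 + d))  ≤⟨ *-monoˡ-≤ (w (1 + d) * w (1 + d)) (n≤1+n (1 + d)) ⟩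
      (2 + d) * (w (1 + d) * w (1 + d))  ∎)
      where open ≤-Reasoning

    -- By the symmetry i ↔ d - i, the mean of (x - i)² is at least (x - d/2)².
    w-suc-lower : ∀ D d → D + d ≡ 2 * x → D ² * w d ≤ 2 * (suc d * w (suc d))
    w-suc-lower D d D+d≡2x = begin
      D ² * w d
        ≡⟨ ∑-*ˡ (suc d) (D ²) _ ⟨
      ∑ (suc d) (λ i → D ² * (b i * b (d ∸ i)))
        ≤⟨ ∑-mono (suc d) (λ i i≤d → bound i (s≤s⁻¹ i≤d)) ⟩
      ∑ (suc d) (λ i → 2 * (F i + F (d ∸ i)))
        ≡⟨ ∑-*ˡ (suc d) 2 _ ⟩
      2 * ∑ (suc d) (λ i → F i + F (d ∸ i))
        ≡⟨ cong (2 *_) (trans (∑-+ (suc d) F _) (cong (S d +_) (∑-reverse d F))) ⟩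
      2 * (S d + S d)
        ≡⟨ cong (λ z → 2 * (S d + z)) (+-identityʳ (S d)) ⟨
      2 * (2 * S d)
        ≡⟨ cong (2 *_) (w-suc d) ⟨
      2 * (suc d * w (suc d)) ∎
      where
      open ≤-Reasoning
      F : ℕ → ℕ
      F i = (x ∸ i) ² * (b i * b (d ∸ i))
      -- Truncation can only enlarge the two differences, whose true sum is 2x - d = D.
      D≤ : ∀ i → i ≤ d → D ≤ (x ∸ i) + (x ∸ (d ∸ i))
      D≤ i i≤d = +-cancelʳ-≤ d D _ (begin
        D + d                                        ≡⟨ D+d≡2x ⟩
        x + (x + 0)                                  ≡⟨ cong (x +_) (+-identityʳ x) ⟩
        x + x                                        ≤⟨ +-mono-≤ (m≤n+m∸n x i) (m≤n+m∸n x (d ∸ i)) ⟩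
        i + (x ∸ i) + ((d ∸ i) + (x ∸ (d ∸ i)))      ≡⟨ shuffle i (x ∸ i) (d ∸ i) (x ∸ (d ∸ i)) ⟩
        (x ∸ i) + (x ∸ (d ∸ i)) + (i + (d ∸ i))      ≡⟨ cong ((x ∸ i) + (x ∸ (d ∸ i)) +_) (m+[n∸m]≡n i≤d) ⟩
        (x ∸ i) + (x ∸ (d ∸ i)) + d                  ∎)
        where
        shuffle : ∀ a b c d → a + b + (c + d) ≡ b + d + (a + c)
        shuffle = solve-∀
      -- The deficit is (a - c)²; the case split makes that difference a natural number.
      square-sum : ∀ a c → (a + c) ² ≤ 2 * (a ² + c ²)
      square-sum a c with ≤-total a c
      ... | inj₁ a≤c = subst (λ c → (a + c) ² ≤ 2 * (a ² + c ²)) (m+[n∸m]≡n a≤c)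
                         (≤-trans (m≤m+n _ ((c ∸ a) ²)) (≤-reflexive (expand a (c ∸ a))))
        where
        expand : ∀ a t → (a + (a + t)) * (a + (a + t)) + t * t ≡ 2 * (a * a + (a + t) * (a + t))
        expand = solve-∀
      ... | inj₂ c≤a = subst (λ a → (a + c) ² ≤ 2 * (a ² + c ²)) (m+[n∸m]≡n c≤a)
                         (≤-trans (m≤m+n _ ((a ∸ c) ²)) (≤-reflexive (expand c (a ∸ c))))
        where
        expand : ∀ c t → (c + t + c) * (c + t + c) + t * t ≡ 2 * ((c + t) * (c + t) + c * c)
        expand = solve-∀
      bound : ∀ i → i ≤ d → D ² * (b i * b (d ∸ i)) ≤ 2 * (F i + F (d ∸ i))
      bound i i≤d = begin
        D ² * (b i * b (d ∸ i))
          ≤⟨ *-monoˡ-≤ (b i * b (d ∸ i)) (≤-trans (²-mono (D≤ i i≤d)) (square-sum (x ∸ i) (x ∸ (d ∸ i)))) ⟩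
        2 * ((x ∸ i) ² + (x ∸ (d ∸ i)) ²) * (b i * b (d ∸ i))
          ≡⟨ distrib ((x ∸ i) ²) ((x ∸ (d ∸ i)) ²) (b i) (b (d ∸ i)) ⟩
        2 * (F i + (x ∸ (d ∸ i)) ² * (b (d ∸ i) * b i))
          ≡⟨ cong (λ k → 2 * (F i + (x ∸ (d ∸ i)) ² * (b (d ∸ i) * b k))) (m∸[m∸n]≡n i≤d) ⟨
        2 * (F i + F (d ∸ i)) ∎
        where
        distrib : ∀ a c u v → 2 * (a + c) * (u * v) ≡ 2 * (a * (u * v) + c * (v * u))
        distrib = solve-∀

    -- By induction: if w (d + 1) were 0, `w-suc-lower` would force D² w d = 0, although D = 2x - d
    -- and w d are positive.
    w>0 : ∀ d → d ≤ 2 * x → 0 < w d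
    w>0 zero _ = s≤s z≤n
    w>0 (suc d) d<2x = n≢0⇒n>0 (λ w≡0 → <⇒≱ (0<Dw) (begin
      D ² * w d               ≤⟨ w-suc-lower D d (m∸n+n≡m (<⇒≤ d<2x)) ⟩
      2 * (suc d * w (suc d))   ≡⟨ cong (λ z → 2 * (suc d * z)) w≡0 ⟩
      2 * (suc d * 0)           ≡⟨ cong (2 *_) (*-zeroʳ (suc d)) ⟩
      0                         ∎))
      where
      open ≤-Reasoning
      D = 2 * x ∸ d
      0<D : 0 < D
      0<D = m<n⇒0<n∸m d<2x
      0<Dw : 0 < D ² * w d
      0<Dw = *-mono-≤ (²-mono 0<D) (w>0 d (<⇒≤ d<2x))

  -- Reversing the sum in f: from f to w.

  C-!-+ : ∀ i l → ((i + l) C i) * (i ! * l !) ≡ (i + l) !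
  C-!-+ i l = trans (cong (λ k → ((i + l) C i) * (i ! * k !)) (sym (m+n∸m≡n i l))) (C-! (i + l) i (m≤m+n i l))

  -- For complementary i and j, C(x, i) = C(x, j) and x! = (x)_j i!, so b appears at the reflected
  -- index.
  C-b : ∀ x i j → i + j ≡ x → (x C i) * x ! ≡ i ! * b x j
  C-b x i j refl = begin
    (x C i) * x !                         ≡⟨ cong₂ _*_ (trans (nCk≡nC[n∸k] (m≤m+n i j)) (cong (x C_) (m+n∸m≡n i j))) (sym (fall-! x j (m≤n+m j i))) ⟩
    (x C j) * (fall x j * (x ∸ j) !)      ≡⟨ cong (λ k → (x C j) * (fall x j * k !)) (m+n∸n≡m i j) ⟩
    (x C j) * (fall x j * i !)            ≡⟨ shuffle (x C j) (fall x j) (i !) ⟩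
    i ! * b x j                           ∎
    where
    open ≡-Reasoning
    shuffle : ∀ a b c → a * (b * c) ≡ c * (a * b)
    shuffle = solve-∀

  module _ (x : ℕ) where

    -- The summand of `f x s N`, without the outer factor C(s, N).
    T : ℕ → ℕ → ℕ
    T N i = (x C i) * (x C (N ∸ i)) * (N C i)

    T-product : ∀ i j l k → i + j ≡ x → l + k ≡ x →
      (x !) ² * ((x C i) * (x C l) * ((i + l) C i)) ≡ (i + l) ! * (b x j * b x k)
    T-product i j l k i+j l+k = begin
      (x !) ² * ((x C i) * (x C l) * ((i + l) C i))              ≡⟨ shuffle (x !) (x C i) (x C l) ((i + l) C i) ⟩
      (x C i) * x ! * ((x C l) * x !) * ((i + l) C i)            ≡⟨ cong₂ (λ u v → u * v * ((i + l) C i)) (C-b x i j i+j) (C-b x l k l+k) ⟩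
      i ! * b x j * (l ! * b x k) * ((i + l) C i)                ≡⟨ shuffle′ (i !) (b x j) (l !) (b x k) ((i + l) C i) ⟩
      ((i + l) C i) * (i ! * l !) * (b x j * b x k)              ≡⟨ cong (_* (b x j * b x k)) (C-!-+ i l) ⟩
      (i + l) ! * (b x j * b x k)                                ∎
      where
      open ≡-Reasoning
      shuffle : ∀ X a c d → X * X * (a * c * d) ≡ a * X * (c * X) * d
      shuffle = solve-∀
      shuffle′ : ∀ a b c d e → a * b * (c * d) * e ≡ e * (a * c) * (b * d)
      shuffle′ = solve-∀

    -- The reflection j = x - i turns the summand into a term of the convolution `w x d`. Out of
    -- range both sides vanish: i > N gives d - j > x, and j > d gives N - i > x.
    T-lag : ∀ N d i j → N + d ≡ 2 * x → i + j ≡ x → (x !) ² * T N i ≡ N ! * (b x j * lag (b x) d j)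
    T-lag N d i j N+d i+j with i ≤? N
    ... | no i≰N = trans (cong (λ z → (x !) ² * ((x C i) * (x C (N ∸ i)) * z)) (k>n⇒nCk≡0 (≰⇒> i≰N)))
                     (trans (zero₁ (x !) ((x C i) * (x C (N ∸ i))))
                       (sym (trans (cong (λ z → N ! * (b x j * z)) lag≡0) (zero₂ (N !) (b x j)))))
      where
      zero₁ : ∀ a b → a * a * (b * 0) ≡ 0
      zero₁ = solve-∀
      zero₂ : ∀ a b → a * (b * 0) ≡ 0
      zero₂ = solve-∀
      j+x<d : j + x < d
      j+x<d = +-cancelˡ-< N (j + x) d (begin-strict
        N + (j + x)      <⟨ +-monoˡ-< (j + x) (≰⇒> i≰N) ⟩
        i + (j + x)      ≡⟨ +-assoc i j x ⟨
        i + j + x        ≡⟨ cong₂ _+_ i+j (sym (+-identityʳ x)) ⟩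
        2 * x            ≡⟨ N+d ⟨
        N + d            ∎)
        where open ≤-Reasoning
      lag≡0 : lag (b x) d j ≡ 0
      lag≡0 = trans (lag-≤ (b x) (≤-trans (m≤m+n j x) (<⇒≤ j+x<d))) (b-0 x (d ∸ j)
        (+-cancelˡ-< j x (d ∸ j) (subst (j + x <_) (sym (m+[n∸m]≡n (≤-trans (m≤m+n j x) (<⇒≤ j+x<d)))) j+x<d)))
    ... | yes i≤N with j ≤? d
    ...   | no j≰d = trans (cong (λ z → (x !) ² * ((x C i) * z * (N C i))) (k>n⇒nCk≡0 x<N∸i))
                       (trans (zero₁ (x !) (x C i) (N C i))
                         (sym (trans (cong (λ z → N ! * (b x j * z)) (lag-> (b x) (≰⇒> j≰d))) (zero₂ (N !) (b x j)))))
      where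
      zero₁ : ∀ a b c → a * a * (b * 0 * c) ≡ 0
      zero₁ = solve-∀
      zero₂ : ∀ a b → a * (b * 0) ≡ 0
      zero₂ = solve-∀
      x<N∸i : x < N ∸ i
      x<N∸i = +-cancelˡ-< (i + j) x (N ∸ i) (begin-strict
        i + j + x              ≡⟨ cong₂ _+_ i+j (sym (+-identityʳ x)) ⟩
        2 * x                  ≡⟨ N+d ⟨
        N + d                  <⟨ +-monoʳ-< N (≰⇒> j≰d) ⟩
        N + j                  ≡⟨ cong (_+ j) (m+[n∸m]≡n i≤N) ⟨
        i + (N ∸ i) + j        ≡⟨ shuffle i (N ∸ i) j ⟩
        i + j + (N ∸ i)        ∎)
        where
        open ≤-Reasoning
        shuffle : ∀ a b c → a + b + c ≡ a + c + b
        shuffle = solve-∀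
    ...   | yes j≤d = subst₂ (λ n u → (x !) ² * ((x C i) * (x C (N ∸ i)) * (n C i)) ≡ n ! * (b x j * u))
                        (m+[n∸m]≡n i≤N) (sym (lag-≤ (b x) j≤d)) (T-product i j (N ∸ i) (d ∸ j) i+j l+k)
      where
      l+k : N ∸ i + (d ∸ j) ≡ x
      l+k = +-cancelˡ-≡ (i + j) _ _ (begin
        i + j + (N ∸ i + (d ∸ j))       ≡⟨ shuffle i j (N ∸ i) (d ∸ j) ⟩
        i + (N ∸ i) + (j + (d ∸ j))     ≡⟨ cong₂ _+_ (m+[n∸m]≡n i≤N) (m+[n∸m]≡n j≤d) ⟩
        N + d                           ≡⟨ N+d ⟩
        2 * x                           ≡⟨ cong₂ _+_ (sym i+j) (+-identityʳ x) ⟩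
        i + j + x                       ∎)
        where
        open ≡-Reasoning
        shuffle : ∀ a b c d → a + b + (c + d) ≡ a + c + (b + d)
        shuffle = solve-∀

    -- The ranges up to N, x and d can be exchanged because all terms outside vanish; the reflection
    -- needs the range up to x.
    T-sum : ∀ N d → N + d ≡ 2 * x → (x !) ² * ∑ (suc N) (T N) ≡ N ! * w x d
    T-sum N d N+d = begin
      (x !) ² * ∑ (suc N) (T N)
        ≡⟨ cong ((x !) ² *_) (∑-supported (suc N) (suc x) (T N) T-0ᴺ T-0ˣ) ⟩
      (x !) ² * ∑ (suc x) (T N)
        ≡⟨ cong ((x !) ² *_) (∑-reverse x (T N)) ⟨
      (x !) ² * ∑ (suc x) (λ j → T N (x ∸ j))
        ≡⟨ ∑-*ˡ (suc x) ((x !) ²) _ ⟨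
      ∑ (suc x) (λ j → (x !) ² * T N (x ∸ j))
        ≡⟨ ∑-cong (suc x) (λ j j≤x → T-lag N d (x ∸ j) j N+d (m∸n+n≡m (s≤s⁻¹ j≤x))) ⟩
      ∑ (suc x) (λ j → N ! * (b x j * lag (b x) d j))
        ≡⟨ ∑-*ˡ (suc x) (N !) _ ⟩
      N ! * ∑ (suc x) (λ j → b x j * lag (b x) d j)
        ≡⟨ cong (N ! *_) (∑-supported (suc x) (suc d) _ (λ j x<j → cong (_* lag (b x) d j) (b-0 x j x<j))
             (λ j d<j → trans (cong (b x j *_) (lag-> (b x) d<j)) (*-zeroʳ (b x j)))) ⟩
      N ! * ∑ (suc d) (λ j → b x j * lag (b x) d j)
        ≡⟨ cong (N ! *_) (∑-cong (suc d) (λ j j≤d → cong (b x j *_) (lag-≤ (b x) (s≤s⁻¹ j≤d)))) ⟩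
      N ! * w x d ∎
      where
      open ≡-Reasoning
      T-0ᴺ : ∀ i → N < i → T N i ≡ 0
      T-0ᴺ i N<i = trans (cong ((x C i) * (x C (N ∸ i)) *_) (k>n⇒nCk≡0 N<i)) (*-zeroʳ ((x C i) * (x C (N ∸ i))))
      T-0ˣ : ∀ i → x < i → T N i ≡ 0
      T-0ˣ i x<i = cong (λ z → z * (x C (N ∸ i)) * (N C i)) (k>n⇒nCk≡0 x<i)

    -- If i ≤ x then N - i > x, so one of the two binomials over x is 0.
    T-sum-0 : ∀ N → 2 * x < N → ∑ (suc N) (T N) ≡ 0
    T-sum-0 N 2x<N = ∑-supported (suc N) 0 (T N) (λ i _ → vanish i) (λ i _ → vanish i)
      where
      vanish : ∀ i → T N i ≡ 0
      vanish i with i ≤? x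
      ... | no i≰x = cong (λ z → z * (x C (N ∸ i)) * (N C i)) (k>n⇒nCk≡0 (≰⇒> i≰x))
      ... | yes i≤x = trans (cong (λ z → (x C i) * z * (N C i)) (k>n⇒nCk≡0 x<N∸i)) (cong (_* (N C i)) (*-zeroʳ (x C i)))
        where
        x<N∸i : x < N ∸ i
        x<N∸i = m+n≤o⇒m≤o∸n (suc x) (≤-trans (s≤s (+-monoʳ-≤ x (≤-trans i≤x (m≤m+n x 0)))) 2x<N)

    -- Unimodality of f.

    w-≤-up : ∀ m d → suc d ≤ 2 * x → w x (suc d) ≤ suc m * w x d → w x (2 + d) ≤ suc (suc m) * w x (suc d)
    w-≤-up m d d<2x le = *-cancelʳ-≤ _ _ (w x d) {{>-nonZero (w>0 x d (<⇒≤ d<2x))}} (begin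
      w x (2 + d) * w x d                    ≤⟨ w-logConcave x d ⟩
      w x (suc d) * w x (suc d)              ≤⟨ *-monoʳ-≤ (w x (suc d)) (≤-trans le (*-monoˡ-≤ (w x d) (n≤1+n (suc m)))) ⟩
      w x (suc d) * (suc (suc m) * w x d)    ≡⟨ shuffle (w x (suc d)) (2 + m) (w x d) ⟩
      suc (suc m) * w x (suc d) * w x d      ∎)
      where
      open ≤-Reasoning
      shuffle : ∀ a b c → a * (b * c) ≡ b * a * c
      shuffle = solve-∀

    -- As w (d + 1) / w d decreases in d, an ascent f (N - 1) ≤ f N passes on to smaller N
    -- (`w-≤-up`), and a descent f (N + 1) ≤ f N to larger N (this lemma). The change of the factor
    -- in m only helps.
    w-≥-down : ∀ m d → suc d ≤ 2 * x → suc m * w x (suc d) ≤ w x (2 + d) → m * w x d ≤ w x (suc d)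
    w-≥-down m d d<2x le = *-cancelʳ-≤ _ _ (w x (suc d)) {{>-nonZero (w>0 x (suc d) d<2x)}} (begin
      m * w x d * w x (suc d)              ≤⟨ *-monoˡ-≤ (w x (suc d)) (*-monoˡ-≤ (w x d) (n≤1+n m)) ⟩
      suc m * w x d * w x (suc d)          ≡⟨ shuffle (suc m) (w x d) (w x (suc d)) ⟩
      suc m * w x (suc d) * w x d          ≤⟨ *-monoˡ-≤ (w x d) le ⟩
      w x (2 + d) * w x d                  ≤⟨ w-logConcave x d ⟩
      w x (suc d) * w x (suc d)            ∎)
      where
      open ≤-Reasoning
      shuffle : ∀ a b c → a * b * c ≡ a * c * b
      shuffle = solve-∀

    module _ (s : ℕ) where

      f-w : ∀ N m d → N + m ≡ s → N + d ≡ 2 * x → (x !) ² * m ! * f x s N ≡ s ! * w x d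
      f-w N m d refl N+d = begin
        (x !) ² * m ! * ((s C N) * sumT)              ≡⟨ cong (λ t → (x !) ² * m ! * ((s C N) * t)) (sum-upTo (suc N) (T N)) ⟩
        (x !) ² * m ! * ((s C N) * ∑ (suc N) (T N))   ≡⟨ shuffle ((x !) ²) (m !) (s C N) (∑ (suc N) (T N)) ⟩
        (s C N) * m ! * ((x !) ² * ∑ (suc N) (T N))   ≡⟨ cong ((s C N) * m ! *_) (T-sum N d N+d) ⟩
        (s C N) * m ! * (N ! * w x d)                 ≡⟨ shuffle′ (s C N) (m !) (N !) (w x d) ⟩
        (s C N) * (N ! * m !) * w x d                 ≡⟨ cong (_* w x d) (C-!-+ N m) ⟩
        s ! * w x d                                   ∎
        where
        open ≡-Reasoning
        sumT = _
        shuffle : ∀ a b c d → a * b * (c * d) ≡ c * b * (a * d)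
        shuffle = solve-∀
        shuffle′ : ∀ a b c d → a * b * (c * d) ≡ a * (c * b) * d
        shuffle′ = solve-∀

      private
        scale≢0 : ∀ m → NonZero ((x !) ² * m !)
        scale≢0 m = m*n≢0 _ _ {{m*n≢0 _ _ {{x !≢0}} {{x !≢0}}}} {{m !≢0}}

      -- By `f-w`, f (N + 1) / f N is (m + 1) w d / w (d + 1), the factor m + 1 being (m + 1)! / m!.
      f-≤-suc : ∀ N m d → suc N + m ≡ s → suc N + d ≡ 2 * x → w x (suc d) ≤ suc m * w x d → f x s N ≤ f x s (suc N)
      f-≤-suc N m d N+m N+d le = *-cancelˡ-≤ ((x !) ² * suc m !) {{scale≢0 (suc m)}} (begin
        (x !) ² * suc m ! * f x s N                ≡⟨ f-w N (suc m) (suc d) (trans (+-suc N m) N+m) (trans (+-suc N d) N+d) ⟩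
        s ! * w x (suc d)                          ≤⟨ *-monoʳ-≤ (s !) le ⟩
        s ! * (suc m * w x d)                      ≡⟨ shuffle (s !) (suc m) (w x d) ⟩
        suc m * (s ! * w x d)                      ≡⟨ cong (suc m *_) (f-w (suc N) m d N+m N+d) ⟨
        suc m * ((x !) ² * m ! * f x s (suc N))    ≡⟨ shuffle′ (suc m) ((x !) ²) (m !) (f x s (suc N)) ⟩
        (x !) ² * suc m ! * f x s (suc N)          ∎)
        where
        open ≤-Reasoning
        shuffle : ∀ a b c → a * (b * c) ≡ b * (a * c)
        shuffle = solve-∀
        shuffle′ : ∀ a b c d → a * (b * c * d) ≡ b * (a * c) * d
        shuffle′ = solve-∀

      f-suc-≤ : ∀ N m d → suc N + m ≡ s → suc N + d ≡ 2 * x → suc m * w x d ≤ w x (suc d) → f x s (suc N) ≤ f x s N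
      f-suc-≤ N m d N+m N+d le = *-cancelˡ-≤ ((x !) ² * suc m !) {{scale≢0 (suc m)}} (begin
        (x !) ² * suc m ! * f x s (suc N)          ≡⟨ shuffle′ (suc m) ((x !) ²) (m !) (f x s (suc N)) ⟨
        suc m * ((x !) ² * m ! * f x s (suc N))    ≡⟨ cong (suc m *_) (f-w (suc N) m d N+m N+d) ⟩
        suc m * (s ! * w x d)                      ≡⟨ shuffle (s !) (suc m) (w x d) ⟨
        s ! * (suc m * w x d)                      ≤⟨ *-monoʳ-≤ (s !) le ⟩
        s ! * w x (suc d)                          ≡⟨ f-w N (suc m) (suc d) (trans (+-suc N m) N+m) (trans (+-suc N d) N+d) ⟨
        (x !) ² * suc m ! * f x s N                ∎)
        where
        open ≤-Reasoning
        shuffle : ∀ a b c → a * (b * c) ≡ b * (a * c)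
        shuffle = solve-∀
        shuffle′ : ∀ a b c d → a * (b * c * d) ≡ b * (a * c) * d
        shuffle′ = solve-∀

      -- The d of this module is d₀ - 1. `below` is the condition for f (D - 1) ≤ f D and `above`
      -- the one for f (D + 1) ≤ f D; both spread outwards from D.
      module _ {D m d : ℕ} (D+m : D + m ≡ s) (D+1+d : D + suc d ≡ 2 * x)
               (below : w x (2 + d) ≤ suc m * w x (suc d)) (above : m * w x d ≤ w x (suc d)) where

        private
          ascent-ratio : ∀ k → k ≤ D → w x (2 + (k + d)) ≤ suc (k + m) * w x (suc (k + d))
          ascent-ratio zero _ = below
          ascent-ratio (suc k) k<D = w-≤-up (k + m) (suc (k + d))
            (≤-trans (≤-reflexive (sym (+-suc (suc k) d))) (≤-trans (+-monoˡ-≤ (suc d) k<D) (≤-reflexive D+1+d)))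
            (ascent-ratio k (<⇒≤ k<D))

          ascent : ∀ k N → N + k ≡ D → f x s N ≤ f x s D
          ascent zero N N+k = ≤-reflexive (cong (f x s) (trans (sym (+-identityʳ N)) N+k))
          ascent (suc k) N N+k = ≤-trans
            (f-≤-suc N (k + m) (suc (k + d)) (trans (sym (+-assoc (suc N) k m)) (trans (cong (_+ m) eq) D+m))
               (trans (shuffle N k d) (trans (cong (_+ suc d) eq) D+1+d))
               (ascent-ratio k (≤-trans (m≤n+m k (suc N)) (≤-reflexive eq))))
            (ascent k (suc N) eq)
            where
            eq : suc N + k ≡ D
            eq = trans (sym (+-suc N k)) N+k
            shuffle : ∀ N k d → suc N + suc (k + d) ≡ suc N + k + suc d
            shuffle = solve-∀

          -- `n` and `e` are m - k and d - k, given by equations so that no truncated subtraction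
          -- enters.
          descent-ratio : ∀ k n e → n + k ≡ m → e + k ≡ d → n * w x e ≤ w x (suc e)
          descent-ratio zero n e n+k e+k =
            subst₂ (λ n e → n * w x e ≤ w x (suc e)) (sym (trans (sym (+-identityʳ n)) n+k)) (sym (trans (sym (+-identityʳ e)) e+k)) above
          descent-ratio (suc k) n e n+k e+k = w-≥-down n e
            (≤-trans (≤-trans (s≤s (≤-trans (m≤m+n e (suc k)) (≤-reflexive e+k))) (m≤n+m (suc d) D)) (≤-reflexive D+1+d))
            (descent-ratio k (suc n) (suc e) (trans (sym (+-suc n k)) n+k) (trans (sym (+-suc e k)) e+k))

          descent : ∀ k n e → n + k ≡ m → e + k ≡ suc d → f x s (k + D) ≤ f x s D
          descent zero n e n+k e+k = ≤-refl
          descent (suc k) n e n+k e+k = ≤-trans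
            (f-suc-≤ (k + D) n e (trans (shuffle k D n) (trans (cong (D +_) n+k) D+m))
              (trans (shuffle k D e) (trans (cong (D +_) e+k) D+1+d))
              (descent-ratio k (suc n) e (trans (sym (+-suc n k)) n+k) (suc-injective (trans (sym (+-suc e k)) e+k))))
            (descent k (suc n) (suc e) (trans (sym (+-suc n k)) n+k) (trans (sym (+-suc e k)) e+k))
            where
            shuffle : ∀ k D n → suc (k + D) + n ≡ D + (n + suc k)
            shuffle = solve-∀

        argMax : IsArgMax x s D
        argMax M with ≤-total M D
        ... | inj₁ M≤D = ascent (D ∸ M) M (m+[n∸m]≡n M≤D)
        -- Above s the factor C(s, M) is 0, and above 2x the inner sum is 0. Otherwise the distances
        -- from M to s and 2x are the n and e of `descent`.
        ... | inj₂ D≤M with M ≤? s | M ≤? 2 * x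
        ...   | no M≰s | _ = ≤-trans (≤-reflexive (cong (_* _) (k>n⇒nCk≡0 (≰⇒> M≰s)))) z≤n
        ...   | yes _ | no M≰2x = ≤-trans (≤-reflexive (trans
            (cong ((s C M) *_) (trans (sum-upTo (suc M) (T M)) (T-sum-0 M (≰⇒> M≰2x)))) (*-zeroʳ (s C M)))) z≤n
        ...   | yes M≤s | yes M≤2x = subst (λ M → f x s M ≤ f x s D) (m∸n+n≡m D≤M)
            (descent (M ∸ D) (s ∸ M) (2 * x ∸ M) (gap D+m M≤s) (gap D+1+d M≤2x))
            where
            gap : ∀ {t e} → D + e ≡ t → M ≤ t → t ∸ M + (M ∸ D) ≡ e
            gap {t} {e} D+e M≤t = +-cancelˡ-≡ D _ _ (begin
              D + (t ∸ M + (M ∸ D))   ≡⟨ shuffle D (t ∸ M) (M ∸ D) ⟩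
              D + (M ∸ D) + (t ∸ M)   ≡⟨ cong (_+ (t ∸ M)) (m+[n∸m]≡n D≤M) ⟩
              M + (t ∸ M)             ≡⟨ m+[n∸m]≡n M≤t ⟩
              t                       ≡⟨ D+e ⟨
              D + e                   ∎)
              where
              open ≡-Reasoning
              shuffle : ∀ a b c → a + (b + c) ≡ a + c + b
              shuffle = solve-∀

  -- Integer consequences of the bounds on E.

  module _ (x s d : ℕ) (lower : (1 + d) * (d + 2 + 2 * s) < 4 * (x * x + x)) where

    -- `lower` is E > 0 multiplied by 2 (d + 1). It fails for d ≥ 2x because 4 (x² + x) = 2x (2x +
    -- 2).
    lower⇒d<2x : d < 2 * x
    lower⇒d<2x = ≰⇒> λ 2x≤d → <⇒≱ lower (begin
      4 * (x * x + x)              ≡⟨ factor x ⟩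
      2 * x * (2 * x + 2)          ≤⟨ *-mono-≤ (m≤n⇒m≤1+n 2x≤d) (≤-trans (+-monoˡ-≤ 2 2x≤d) (m≤m+n (d + 2) (2 * s))) ⟩
      (1 + d) * (d + 2 + 2 * s)    ∎)
      where
      open ≤-Reasoning
      factor : ∀ x → 4 * (x * x + x) ≡ 2 * x * (2 * x + 2)
      factor = solve-∀

    module _ {D : ℕ} (D+d≡2x : D + d ≡ 2 * x) where

      private
        -- The part that 4 (x² + x), written with 2x = D + d, shares with (d + 1)(d + 2 + 2D);
        -- cancelling it leaves D² against d + 2.
        common : ℕ
        common = d * d + 2 * d * D + 2 * D + 2 * d

        4[x²+x] : 4 * (x * x + x) ≡ common + D * D
        4[x²+x] = trans (factor x) (trans (cong (λ z → z * (z + 2)) (sym D+d≡2x)) (expand D d))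
          where
          factor : ∀ x → 4 * (x * x + x) ≡ 2 * x * (2 * x + 2)
          factor = solve-∀
          expand : ∀ D d → (D + d) * (D + d + 2) ≡ d * d + 2 * d * D + 2 * D + 2 * d + D * D
          expand = solve-∀

      -- The second hypothesis is E < 1 multiplied by 2 (d + 1). If s < D, it gives D² < d + 2,
      -- hence (2s + 1)² ≤ 4D² + 1 ≤ 4d + 9 ≤ 8x + 9, against the assumed lower bound on s₂.
      D≤s : 8 * x + 9 < (2 * s + 1) * (2 * s + 1) → 4 * (x * x + x) < (1 + d) * (d + 2 + 2 * s) + 2 * (1 + d) → D ≤ s
      D≤s s-large upper = ≮⇒≥ λ s<D → <⇒≱ s-large (begin
        (2 * s + 1) * (2 * s + 1)    ≡⟨ expand s ⟩
        4 * (s * suc s) + 1          ≤⟨ +-monoˡ-≤ 1 (*-monoʳ-≤ 4 (*-mono-≤ (<⇒≤ s<D) s<D)) ⟩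
        4 * (D * D) + 1              ≤⟨ +-monoˡ-≤ 1 (*-monoʳ-≤ 4 (<⇒≤ (D²<d+2 s<D))) ⟩
        4 * (d + 2) + 1              ≤⟨ m≤m+n _ (4 * D) ⟩
        4 * (d + 2) + 1 + 4 * D      ≡⟨ collect D d ⟩
        4 * (D + d) + 9              ≡⟨ cong (λ z → 4 * z + 9) D+d≡2x ⟩
        4 * (2 * x) + 9              ≡⟨ cong (_+ 9) (sym (*-assoc 4 2 x)) ⟩
        8 * x + 9                    ∎)
        where
        open ≤-Reasoning
        expand : ∀ s → (2 * s + 1) * (2 * s + 1) ≡ 4 * (s * (1 + s)) + 1
        expand = solve-∀
        collect : ∀ D d → 4 * (d + 2) + 1 + 4 * D ≡ 4 * (D + d) + 9
        collect = solve-∀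
        D²<d+2 : s < D → D * D < d + 2
        D²<d+2 s<D = +-cancelˡ-< common (D * D) (d + 2) (begin-strict
          common + D * D                                ≡⟨ 4[x²+x] ⟨
          4 * (x * x + x)                               <⟨ upper ⟩
          (1 + d) * (d + 2 + 2 * s) + 2 * (1 + d)       ≡⟨ absorb s d ⟩
          (1 + d) * (d + 2 + 2 * (1 + s))               ≤⟨ *-monoʳ-≤ (1 + d) (+-monoʳ-≤ (d + 2) (*-monoʳ-≤ 2 s<D)) ⟩
          (1 + d) * (d + 2 + 2 * D)                     ≡⟨ expand′ D d ⟩
          common + (d + 2)                              ∎)
          where
          absorb : ∀ s d → (1 + d) * (d + 2 + 2 * s) + 2 * (1 + d) ≡ (1 + d) * (d + 2 + 2 * (1 + s))
          absorb = solve-∀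
          expand′ : ∀ D d → (1 + d) * (d + 2 + 2 * D) ≡ d * d + 2 * d * D + 2 * D + 2 * d + (d + 2)
          expand′ = solve-∀

      -- Serves twice: d + 2 ≤ D² is the domain of the conjecture, and 2 (d + 1) m ≤ D² feeds
      -- `w-above`.
      D²-lower : ∀ {m} → D + m ≡ s → d + 2 + 2 * (1 + d) * m < D * D
      D²-lower {m} D+m≡s = +-cancelˡ-< common _ (D * D) (begin-strict
        common + (d + 2 + 2 * (1 + d) * m)          ≡⟨ expand D d m ⟩
        (1 + d) * (d + 2 + 2 * (D + m))             ≡⟨ cong (λ s → (1 + d) * (d + 2 + 2 * s)) D+m≡s ⟩
        (1 + d) * (d + 2 + 2 * s)                   <⟨ lower ⟩
        4 * (x * x + x)                             ≡⟨ 4[x²+x] ⟩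
        common + D * D                              ∎)
        where
        open ≤-Reasoning
        expand : ∀ D d m → d * d + 2 * d * D + 2 * D + 2 * d + (d + 2 + 2 * (1 + d) * m) ≡ (1 + d) * (d + 2 + 2 * (D + m))
        expand = solve-∀

  -- `w-suc-lower` is applied at e = d₀ - 1, where 2x - e is D + 1, and D² ≤ (D + 1)².
  w-above : ∀ x {D m e} → D + suc e ≡ 2 * x → 2 * suc e * m ≤ D * D → m * w x e ≤ w x (suc e)
  w-above x {D} {m} {e} D+1+e≡2x bound = *-cancelˡ-≤ (2 * suc e) (begin
    2 * suc e * (m * w x e)       ≡⟨ *-assoc (2 * suc e) m (w x e) ⟨
    2 * suc e * m * w x e         ≤⟨ *-monoˡ-≤ (w x e) (≤-trans bound (*-mono-≤ (n≤1+n D) (n≤1+n D))) ⟩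
    (suc D) ² * w x e             ≤⟨ w-suc-lower x (suc D) e (trans (sym (+-suc D e)) D+1+e≡2x) ⟩
    2 * (suc e * w x (suc e))     ≡⟨ *-assoc 2 (suc e) (w x (suc e)) ⟨
    2 * suc e * w x (suc e)       ∎)
    where open ≤-Reasoning

-- Transfer between natural numbers and rationals.

open Naturals
open import Data.Integer using (ℤ; +_)
open import Data.Rational using (ℚ; 0ℚ; 1ℚ; _+_; _*_; _-_; -_; _≤_; _<_; ≢-nonZero; toℚᵘ; positive; nonNegative)
open +-*-Solver using (solve; con; _:=_; _:+_; _:*_; _:-_; :-_)

-- `i ℚ./ 1` is normalised by a gcd and does not compute for a variable i, so arithmetic and order
-- are compared on unnormalised rationals.
toℚᵘ-/1 : ∀ i → toℚᵘ (i ℚ./ 1) ℚᵘ.≃ ℚᵘ.mkℚᵘ i 0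
toℚᵘ-/1 i = ℚ.toℚᵘ-fromℚᵘ (ℚᵘ.mkℚᵘ i 0)

/1-+ : ∀ i j → (i ℚ./ 1) + (j ℚ./ 1) ≡ (i ℤ.+ j) ℚ./ 1
/1-+ i j = ℚ.toℚᵘ-injective (ℚᵘ.≃-trans (ℚ.toℚᵘ-homo-+ (i ℚ./ 1) (j ℚ./ 1))
  (ℚᵘ.≃-trans (ℚᵘ.+-cong (toℚᵘ-/1 i) (toℚᵘ-/1 j))
    (ℚᵘ.≃-trans (ℚᵘ.*≡* (cong (ℤ._* + 1) (cong₂ ℤ._+_ (ℤ.*-identityʳ i) (ℤ.*-identityʳ j)))) (ℚᵘ.≃-sym (toℚᵘ-/1 (i ℤ.+ j))))))

/1-* : ∀ i j → (i ℚ./ 1) * (j ℚ./ 1) ≡ (i ℤ.* j) ℚ./ 1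
/1-* i j = ℚ.toℚᵘ-injective (ℚᵘ.≃-trans (ℚ.toℚᵘ-homo-* (i ℚ./ 1) (j ℚ./ 1))
  (ℚᵘ.≃-trans (ℚᵘ.*-cong (toℚᵘ-/1 i) (toℚᵘ-/1 j)) (ℚᵘ.≃-sym (toℚᵘ-/1 (i ℤ.* j)))))

/1-mono-≤ : ∀ i j → i ℤ.≤ j → i ℚ./ 1 ≤ j ℚ./ 1
/1-mono-≤ i j i≤j = ℚ.toℚᵘ-cancel-≤ (ℚᵘ.≤-respʳ-≃ (ℚᵘ.≃-sym (toℚᵘ-/1 j)) (ℚᵘ.≤-respˡ-≃ (ℚᵘ.≃-sym (toℚᵘ-/1 i))
  (ℚᵘ.*≤* (ℤ.*-monoʳ-≤-nonNeg (+ 1) i≤j))))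

/1-cancel-< : ∀ i j → i ℚ./ 1 < j ℚ./ 1 → i ℤ.< j
/1-cancel-< i j i<j with i ℤ.<? j
... | yes p = p
... | no i≮j = contradiction (ℚ.<-≤-trans i<j (/1-mono-≤ j i (ℤ.≮⇒≥ i≮j))) (ℚ.<-irrefl refl)

/1-cancel-≤ : ∀ i j → i ℚ./ 1 ≤ j ℚ./ 1 → i ℤ.≤ j
/1-cancel-≤ i j i≤j = ℚᵘ-cancel (ℚᵘ.≤-respʳ-≃ (toℚᵘ-/1 j) (ℚᵘ.≤-respˡ-≃ (toℚᵘ-/1 i) (ℚ.toℚᵘ-mono-≤ i≤j)))
  where
  ℚᵘ-cancel : ℚᵘ.mkℚᵘ i 0 ℚᵘ.≤ ℚᵘ.mkℚᵘ j 0 → i ℤ.≤ j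
  ℚᵘ-cancel (ℚᵘ.*≤* p) = subst₂ ℤ._≤_ (ℤ.*-identityʳ i) (ℤ.*-identityʳ j) p

/1-mono-< : ∀ i j → i ℤ.< j → i ℚ./ 1 < j ℚ./ 1
/1-mono-< i j i<j = ℚ.≰⇒> (λ j≤i → ℤ.<⇒≱ i<j (/1-cancel-≤ j i j≤i))

⟦⟧-+ : ∀ m n → ⟦ m ⟧ + ⟦ n ⟧ ≡ ⟦ m ℕ.+ n ⟧
⟦⟧-+ m n = /1-+ (+ m) (+ n)

⟦⟧-* : ∀ m n → ⟦ m ⟧ * ⟦ n ⟧ ≡ ⟦ m ℕ.* n ⟧
⟦⟧-* m n = trans (/1-* (+ m) (+ n)) (cong (ℚ._/ 1) (sym (ℤ.pos-* m n)))

⟦⟧-mono-≤ : ∀ m n → m ℕ.≤ n → ⟦ m ⟧ ≤ ⟦ n ⟧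
⟦⟧-mono-≤ m n m≤n = /1-mono-≤ (+ m) (+ n) (ℤ.+≤+ m≤n)

⟦⟧-mono-< : ∀ m n → m ℕ.< n → ⟦ m ⟧ < ⟦ n ⟧
⟦⟧-mono-< m n m<n = /1-mono-< (+ m) (+ n) (ℤ.+<+ m<n)

⟦⟧-cancel-≤ : ∀ m n → ⟦ m ⟧ ≤ ⟦ n ⟧ → m ℕ.≤ n
⟦⟧-cancel-≤ m n m≤n = ℤ.drop‿+≤+ (/1-cancel-≤ (+ m) (+ n) m≤n)

⟦⟧-cancel-< : ∀ m n → ⟦ m ⟧ < ⟦ n ⟧ → m ℕ.< n
⟦⟧-cancel-< m n m<n = ℤ.drop‿+<+ (/1-cancel-< (+ m) (+ n) m<n)

⟦⟧-∸ : ∀ {m n} → n ℕ.≤ m → ⟦ m ⟧ - ⟦ n ⟧ ≡ ⟦ m ∸ n ⟧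
⟦⟧-∸ {m} {n} n≤m = trans (cong (λ k → ⟦ k ⟧ - ⟦ n ⟧) (sym (ℕ.m∸n+n≡m n≤m)))
  (trans (cong (_- ⟦ n ⟧) (sym (⟦⟧-+ (m ∸ n) n)))
    (solve 2 (λ a c → (a :+ c) :- c := a) refl ⟦ m ∸ n ⟧ ⟦ n ⟧))

0<⟦suc⟧ : ∀ n → 0ℚ < ⟦ suc n ⟧
0<⟦suc⟧ n = ⟦⟧-mono-< 0 (suc n) (ℕ.s≤s ℕ.z≤n)

÷₀-* : ∀ p {q} → 0ℚ < q → p ÷₀ q * q ≡ p
÷₀-* p {q} 0<q with q ℚ.≟ 0ℚ
... | yes q≡0 = contradiction (sym q≡0) (ℚ.<⇒≢ 0<q)
... | no q≢0 = trans (ℚ.*-assoc p _ q) (trans (cong (p *_) (ℚ.*-inverseˡ q {{≢-nonZero q≢0}})) (ℚ.*-identityʳ p))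

*-cancelʳ-≤ : ∀ {p q r} → 0ℚ < r → p * r ≤ q * r → p ≤ q
*-cancelʳ-≤ {r = r} 0<r = ℚ.*-cancelʳ-≤-pos r {{positive 0<r}}

*-monoʳ-≤ : ∀ {p q r} → 0ℚ ≤ r → p ≤ q → p * r ≤ q * r
*-monoʳ-≤ {r = r} 0≤r = ℚ.*-monoʳ-≤-nonNeg r {{nonNegative 0≤r}}

*-monoʳ-< : ∀ {p q r} → 0ℚ < r → p < q → p * r < q * r
*-monoʳ-< {r = r} 0<r = ℚ.*-monoˡ-<-pos r {{positive 0<r}}

÷₀-unique : ∀ {p q r} → 0ℚ < q → r * q ≡ p → p ÷₀ q ≡ r
÷₀-unique {p} {q} 0<q eq = ℚ.≤-antisym
  (*-cancelʳ-≤ 0<q (ℚ.≤-reflexive (trans (÷₀-* p 0<q) (sym eq))))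
  (*-cancelʳ-≤ 0<q (ℚ.≤-reflexive (trans eq (sym (÷₀-* p 0<q)))))

square-mono-≤ : ∀ {p q} → 0ℚ ≤ p → p ≤ q → p * p ≤ q * q
square-mono-≤ {p} {q} 0≤p p≤q = ℚ.≤-trans (*-monoʳ-≤ 0≤p p≤q)
  (subst (_≤ q * q) (ℚ.*-comm p q) (*-monoʳ-≤ (ℚ.≤-trans 0≤p p≤q) p≤q))

≤-shift : ∀ t {p q p′ q′} → p ≤ q → p + t ≡ p′ → q + t ≡ q′ → p′ ≤ q′
≤-shift t p≤q refl refl = ℚ.+-monoˡ-≤ t p≤q

<-shift : ∀ t {p q p′ q′} → p < q → p + t ≡ p′ → q + t ≡ q′ → p′ < q′
<-shift t p<q refl refl = ℚ.+-monoˡ-< t p<q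

-- The polynomials P_d at natural arguments.

ff-fall : ∀ x i → ff ⟦ x ⟧ i ≡ ⟦ fall x i ⟧
ff-fall x zero = refl
ff-fall x (suc i) with i ℕ.≤? x
... | yes i≤x = trans (cong₂ _*_ (ff-fall x i) (⟦⟧-∸ i≤x)) (⟦⟧-* (fall x i) (x ∸ i))
-- Past x the rational factor x - i is negative while `x ∸ i` is 0, but the preceding product is
-- already 0 on both sides.
... | no i≰x = trans (cong (_* (⟦ x ⟧ - ⟦ i ⟧)) (trans (ff-fall x i) (cong ⟦_⟧ fall≡0)))
                 (trans (ℚ.*-zeroˡ (⟦ x ⟧ - ⟦ i ⟧)) (cong (λ z → ⟦ z ℕ.* (x ∸ i) ⟧) (sym fall≡0)))
  where fall≡0 = fall-0 x i (ℕ.≰⇒> i≰x)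

Σ≤-∑ : ∀ n {F : ℕ → ℚ} {G : ℕ → ℕ} → (∀ i → F i ≡ ⟦ G i ⟧) → Σ≤ n F ≡ ⟦ ∑ (suc n) G ⟧
Σ≤-∑ zero e = e 0
Σ≤-∑ (suc n) {G = G} e = trans (cong₂ _+_ (Σ≤-∑ n e) (e (suc n))) (⟦⟧-+ (∑ (suc n) G) (G (suc n)))

-- After clearing the denominator, `C-fall` identifies (x)_i² / i! with the integer b i.
P-w : ∀ x d → P d ⟦ x ⟧ ≡ ⟦ w x d ⟧
P-w x d = Σ≤-∑ d term
  where
  open ≡-Reasoning
  term : ∀ i → (ff ⟦ x ⟧ i * ff ⟦ x ⟧ i * ff ⟦ x ⟧ (d ∸ i) * ff ⟦ x ⟧ (d ∸ i)) ÷₀ ⟦ i ! ℕ.* (d ∸ i) ! ⟧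
               ≡ ⟦ b x i ℕ.* b x (d ∸ i) ⟧
  term i = ÷₀-unique (⟦⟧-mono-< 0 (i ! ℕ.* (d ∸ i) !) (ℕ.>-nonZero⁻¹ _ {{i ℕ.!* (d ∸ i) !≢0}})) (begin
    ⟦ b x i ℕ.* b x j ⟧ * ⟦ i ! ℕ.* j ! ⟧            ≡⟨ ⟦⟧-* (b x i ℕ.* b x j) (i ! ℕ.* j !) ⟩
    ⟦ b x i ℕ.* b x j ℕ.* (i ! ℕ.* j !) ⟧            ≡⟨ cong ⟦_⟧ (shuffle (x C i) F (x C j) G (i !) (j !)) ⟩
    ⟦ (x C i) ℕ.* i ! ℕ.* F ℕ.* ((x C j) ℕ.* j !) ℕ.* G ⟧ ≡⟨ cong₂ (λ u v → ⟦ u ℕ.* F ℕ.* v ℕ.* G ⟧) (C-fall x i) (C-fall x j) ⟩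
    ⟦ F ℕ.* F ℕ.* G ℕ.* G ⟧                          ≡⟨ ⟦⟧-* (F ℕ.* F ℕ.* G) G ⟨
    ⟦ F ℕ.* F ℕ.* G ⟧ * ⟦ G ⟧                        ≡⟨ cong (_* ⟦ G ⟧) (⟦⟧-* (F ℕ.* F) G) ⟨
    ⟦ F ℕ.* F ⟧ * ⟦ G ⟧ * ⟦ G ⟧                      ≡⟨ cong (λ z → z * ⟦ G ⟧ * ⟦ G ⟧) (⟦⟧-* F F) ⟨
    ⟦ F ⟧ * ⟦ F ⟧ * ⟦ G ⟧ * ⟦ G ⟧                    ≡⟨ cong₂ (λ u v → u * u * v * v) (ff-fall x i) (ff-fall x j) ⟨
    ff ⟦ x ⟧ i * ff ⟦ x ⟧ i * ff ⟦ x ⟧ j * ff ⟦ x ⟧ j ∎)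
    where
    j = d ∸ i
    F = fall x i
    G = fall x j
    shuffle : ∀ a F c G p q → a ℕ.* F ℕ.* (c ℕ.* G) ℕ.* (p ℕ.* q) ≡ a ℕ.* p ℕ.* F ℕ.* (c ℕ.* q) ℕ.* G
    shuffle = solve-∀

-- Indexing by the natural number lets Agda infer it, which it cannot do through ⟦_⟧.
data _≐_ (p : ℚ) (n : ℕ) : Set where
  cast : p ≡ ⟦ n ⟧ → p ≐ n

infix 4 _≐_
infixl 6 _⊕_
infixl 7 _⊗_

ι : ∀ n → ⟦ n ⟧ ≐ n
ι n = cast refl

_⊕_ : ∀ {p q m n} → p ≐ m → q ≐ n → p + q ≐ m ℕ.+ n
_⊕_ {m = m} {n} (cast e) (cast e′) = cast (trans (cong₂ _+_ e e′) (⟦⟧-+ m n))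

_⊗_ : ∀ {p q m n} → p ≐ m → q ≐ n → p * q ≐ m ℕ.* n
_⊗_ {m = m} {n} (cast e) (cast e′) = cast (trans (cong₂ _*_ e e′) (⟦⟧-* m n))

≐-< : ∀ {p q m n} → p ≐ m → q ≐ n → p < q → m ℕ.< n
≐-< {m = m} {n} (cast e) (cast e′) p<q = ⟦⟧-cancel-< m n (subst₂ _<_ e e′ p<q)

≐-≤ : ∀ {p q m n} → p ≐ m → q ≐ n → p ≤ q → m ℕ.≤ n
≐-≤ {m = m} {n} (cast e) (cast e′) p≤q = ⟦⟧-cancel-≤ m n (subst₂ _≤_ e e′ p≤q)

<-≐ : ∀ {p q m n} → p ≐ m → q ≐ n → m ℕ.< n → p < q
<-≐ {m = m} {n} (cast e) (cast e′) m<n = subst₂ _<_ (sym e) (sym e′) (⟦⟧-mono-< m n m<n)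

≤-≐ : ∀ {p q m n} → p ≐ m → q ≐ n → m ℕ.≤ n → p ≤ q
≤-≐ {m = m} {n} (cast e) (cast e′) m≤n = subst₂ _≤_ (sym e) (sym e′) (⟦⟧-mono-≤ m n m≤n)

≡-≐ : ∀ {p q m n} → p ≐ m → q ≐ n → m ≡ n → p ≡ q
≡-≐ (cast e) (cast e′) m≡n = trans e (trans (cong ⟦_⟧ m≡n) (sym e′))

-- Since 0.995 < 1 and 0 < d - 2 ≤ 2x + d - 2. It turns the upper bound on E into E < 1, as `D≤s`
-- requires.
conjecture-bound<1 : ∀ x d → 5 ℕ.≤ d → c995 * (⟦ d ⟧ - ⟦ 2 ⟧) ÷₀ (⟦ 2 ⟧ * ⟦ x ⟧ + ⟦ d ⟧ - ⟦ 2 ⟧) < 1ℚ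
conjecture-bound<1 x d 5≤d = ℚ.≰⇒> λ 1≤C → ℚ.<-irrefl refl (begin-strict
  1ℚ * (⟦ 2 ⟧ * X + Z - ⟦ 2 ⟧)                  ≤⟨ *-monoʳ-≤ (ℚ.<⇒≤ den>0) 1≤C ⟩
  c995 * (Z - ⟦ 2 ⟧) ÷₀ den * den               ≡⟨ ÷₀-* (c995 * (Z - ⟦ 2 ⟧)) den>0 ⟩
  c995 * (Z - ⟦ 2 ⟧)                            <⟨ *-monoʳ-< Z-2>0 c995<1 ⟩
  1ℚ * (Z - ⟦ 2 ⟧)                              ≡⟨ ℚ.*-identityˡ (Z - ⟦ 2 ⟧) ⟩
  Z - ⟦ 2 ⟧                                     ≤⟨ Z-2≤den ⟩
  ⟦ 2 ⟧ * X + Z - ⟦ 2 ⟧                         ≡⟨ ℚ.*-identityˡ _ ⟨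
  1ℚ * (⟦ 2 ⟧ * X + Z - ⟦ 2 ⟧)                  ∎)
  where
  open ℚ.≤-Reasoning
  X = ⟦ x ⟧
  Z = ⟦ d ⟧
  den : ℚ
  den = ⟦ 2 ⟧ * X + Z - ⟦ 2 ⟧
  c995<1 : c995 < 1ℚ
  c995<1 = ℚ.*<* (ℤ.+<+ (ℕ.n<1+n 199))
  Z-2>0 : 0ℚ < Z - ⟦ 2 ⟧
  Z-2>0 = <-shift (- ⟦ 2 ⟧) (⟦⟧-mono-< 2 d (ℕ.≤-trans (ℕ.s≤s (ℕ.s≤s (ℕ.s≤s ℕ.z≤n))) 5≤d)) refl refl
  Z-2≤den : Z - ⟦ 2 ⟧ ≤ den
  Z-2≤den = ≤-shift (Z - ⟦ 2 ⟧) (≤-≐ (ι 0) (ι 2 ⊗ ι x) ℕ.z≤n) (ℚ.+-identityˡ (Z - ⟦ 2 ⟧)) (sym (ℚ.+-assoc (⟦ 2 ⟧ * X) Z (- ⟦ 2 ⟧)))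
  den>0 : 0ℚ < den
  den>0 = ℚ.<-≤-trans Z-2>0 Z-2≤den

-- The quantity E and the division of P_{d+1} by P_d.

module _ (x s d : ℕ) where

  private
    X = ⟦ x ⟧
    Y = ⟦ s ⟧
    Z = ⟦ d ⟧
    M N : ℚ
    M = ⟦ 4 ⟧ * (X * X + X)
    N = (⟦ 1 ⟧ + Z) * (Z + ⟦ 2 ⟧ + ⟦ 2 ⟧ * Y)

    M≐ : M ≐ 4 ℕ.* (x ℕ.* x ℕ.+ x)
    M≐ = ι 4 ⊗ (ι x ⊗ ι x ⊕ ι x)

    N≐ : N ≐ (1 ℕ.+ d) ℕ.* (d ℕ.+ 2 ℕ.+ 2 ℕ.* s)
    N≐ = (ι 1 ⊕ ι d) ⊗ (ι d ⊕ ι 2 ⊕ ι 2 ⊗ ι s)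

    q h : ℚ
    q = ⟦ 2 ⟧ ÷₀ ⟦ suc d ⟧
    h = (Z + ⟦ 2 ⟧) ÷₀ ⟦ 2 ⟧

    1+Z : ⟦ suc d ⟧ ≡ ⟦ 1 ⟧ + Z
    1+Z = sym (⟦⟧-+ 1 d)

    q-eq : q * (⟦ 1 ⟧ + Z) ≡ ⟦ 2 ⟧
    q-eq = trans (cong (q *_) (sym 1+Z)) (÷₀-* ⟦ 2 ⟧ (0<⟦suc⟧ d))

    h-eq : h * ⟦ 2 ⟧ ≡ Z + ⟦ 2 ⟧
    h-eq = ÷₀-* (Z + ⟦ 2 ⟧) (0<⟦suc⟧ 1)

  -- At N = 2 x - d, f (N - 1) ≤ f N holds iff excess ≤ - R_d(x) / P_d(x).
  excess : ℚ
  excess = q * (X * X + X) - h - Y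

  private
    -- The factor 2 (d + 1) clears both denominators, so bounds on E become inequalities of natural
    -- numbers.
    excess-scaled : excess * (⟦ 2 ⟧ * (⟦ 1 ⟧ + Z)) ≡ M - N
    excess-scaled = begin
      excess * (⟦ 2 ⟧ * (⟦ 1 ⟧ + Z))
        ≡⟨ solve 5 (λ q h u t y →
             (q :* u :- h :- y) :* (con ⟦ 2 ⟧ :* t) := con ⟦ 2 ⟧ :* (q :* t) :* u :- (h :* con ⟦ 2 ⟧) :* t :- con ⟦ 2 ⟧ :* y :* t)
             refl q h (X * X + X) (⟦ 1 ⟧ + Z) Y ⟩
      ⟦ 2 ⟧ * (q * (⟦ 1 ⟧ + Z)) * (X * X + X) - h * ⟦ 2 ⟧ * (⟦ 1 ⟧ + Z) - ⟦ 2 ⟧ * Y * (⟦ 1 ⟧ + Z)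
        ≡⟨ cong₂ (λ a c → ⟦ 2 ⟧ * a * (X * X + X) - c * (⟦ 1 ⟧ + Z) - ⟦ 2 ⟧ * Y * (⟦ 1 ⟧ + Z)) q-eq h-eq ⟩
      ⟦ 2 ⟧ * ⟦ 2 ⟧ * (X * X + X) - (Z + ⟦ 2 ⟧) * (⟦ 1 ⟧ + Z) - ⟦ 2 ⟧ * Y * (⟦ 1 ⟧ + Z)
        ≡⟨ solve 3 (λ u z y → con ⟦ 2 ⟧ :* con ⟦ 2 ⟧ :* u :- (z :+ con ⟦ 2 ⟧) :* (con ⟦ 1 ⟧ :+ z) :- con ⟦ 2 ⟧ :* y :* (con ⟦ 1 ⟧ :+ z)
             := con ⟦ 4 ⟧ :* u :- (con ⟦ 1 ⟧ :+ z) :* (z :+ con ⟦ 2 ⟧ :+ con ⟦ 2 ⟧ :* y)) refl (X * X + X) Z Y ⟩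
      M - N ∎
      where open ≡-Reasoning

    scale>0 : 0ℚ < ⟦ 2 ⟧ * (⟦ 1 ⟧ + Z)
    scale>0 = <-≐ (ι 0) (ι 2 ⊗ (ι 1 ⊕ ι d)) (ℕ.s≤s ℕ.z≤n)

  excess>0 : 0ℚ < excess → (1 ℕ.+ d) ℕ.* (d ℕ.+ 2 ℕ.+ 2 ℕ.* s) ℕ.< 4 ℕ.* (x ℕ.* x ℕ.+ x)
  excess>0 0<e = ≐-< N≐ M≐ (<-shift N
    (subst₂ _<_ (ℚ.*-zeroˡ (⟦ 2 ⟧ * (⟦ 1 ⟧ + Z))) excess-scaled (*-monoʳ-< scale>0 0<e))
    (ℚ.+-identityˡ N) (solve 2 (λ a c → a :- c :+ c := a) refl M N))

  excess<1 : excess < 1ℚ → 4 ℕ.* (x ℕ.* x ℕ.+ x) ℕ.< (1 ℕ.+ d) ℕ.* (d ℕ.+ 2 ℕ.+ 2 ℕ.* s) ℕ.+ 2 ℕ.* (1 ℕ.+ d)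
  excess<1 e<1 = ≐-< M≐ (N≐ ⊕ ι 2 ⊗ (ι 1 ⊕ ι d)) (<-shift N
    (subst₂ _<_ excess-scaled (ℚ.*-identityˡ (⟦ 2 ⟧ * (⟦ 1 ⟧ + Z))) (*-monoʳ-< scale>0 e<1))
    (solve 2 (λ a c → a :- c :+ c := a) refl M N) (ℚ.+-comm (⟦ 2 ⟧ * (⟦ 1 ⟧ + Z)) N))

  private
    -- Both have leading coefficient q. With 2d / (d + 1) = 2 - q and d / 2 = h - 1 all terms in q
    -- cancel; for 2x = D + d and s = D + m the result is m + 1.
    Quot-excess : Quot d X - excess ≡ Y - ⟦ 2 ⟧ * X + Z + ⟦ 1 ⟧
    Quot-excess = begin
      Quot d X - excess
        ≡⟨ cong₂ (λ r k → q * X * X - r * X + k - excess) r-eq k-eq ⟩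
      q * X * X - (⟦ 2 ⟧ - q) * X + (h - ⟦ 1 ⟧) - (q * (X * X + X) - h - Y)
        ≡⟨ solve 4 (λ q x h y → q :* x :* x :- (con ⟦ 2 ⟧ :- q) :* x :+ (h :- con ⟦ 1 ⟧) :- (q :* (x :* x :+ x) :- h :- y)
             := y :- con ⟦ 2 ⟧ :* x :+ (h :* con ⟦ 2 ⟧ :- con ⟦ 1 ⟧)) refl q X h Y ⟩
      Y - ⟦ 2 ⟧ * X + (h * ⟦ 2 ⟧ - ⟦ 1 ⟧)
        ≡⟨ cong (λ z → Y - ⟦ 2 ⟧ * X + (z - ⟦ 1 ⟧)) h-eq ⟩
      Y - ⟦ 2 ⟧ * X + (Z + ⟦ 2 ⟧ - ⟦ 1 ⟧)
        ≡⟨ solve 2 (λ a z → a :+ (z :+ con ⟦ 2 ⟧ :- con ⟦ 1 ⟧) := a :+ z :+ con ⟦ 1 ⟧) refl (Y - ⟦ 2 ⟧ * X) Z ⟩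
      Y - ⟦ 2 ⟧ * X + Z + ⟦ 1 ⟧ ∎
      where
      open ≡-Reasoning
      r-eq : ⟦ 2 ℕ.* d ⟧ ÷₀ ⟦ suc d ⟧ ≡ ⟦ 2 ⟧ - q
      r-eq = ÷₀-unique (0<⟦suc⟧ d) (begin
        (⟦ 2 ⟧ - q) * ⟦ suc d ⟧                 ≡⟨ cong ((⟦ 2 ⟧ - q) *_) 1+Z ⟩
        (⟦ 2 ⟧ - q) * (⟦ 1 ⟧ + Z)               ≡⟨ solve 2 (λ q z → (con ⟦ 2 ⟧ :- q) :* (con ⟦ 1 ⟧ :+ z) := con ⟦ 2 ⟧ :* (con ⟦ 1 ⟧ :+ z) :- q :* (con ⟦ 1 ⟧ :+ z)) refl q Z ⟩
        ⟦ 2 ⟧ * (⟦ 1 ⟧ + Z) - q * (⟦ 1 ⟧ + Z)   ≡⟨ cong (λ u → ⟦ 2 ⟧ * (⟦ 1 ⟧ + Z) - u) q-eq ⟩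
        ⟦ 2 ⟧ * (⟦ 1 ⟧ + Z) - ⟦ 2 ⟧             ≡⟨ solve 1 (λ z → con ⟦ 2 ⟧ :* (con ⟦ 1 ⟧ :+ z) :- con ⟦ 2 ⟧ := con ⟦ 2 ⟧ :* z) refl Z ⟩
        ⟦ 2 ⟧ * Z                               ≡⟨ ⟦⟧-* 2 d ⟩
        ⟦ 2 ℕ.* d ⟧                             ∎)
      k-eq : Z ÷₀ ⟦ 2 ⟧ ≡ h - ⟦ 1 ⟧
      k-eq = ÷₀-unique (0<⟦suc⟧ 1) (begin
        (h - ⟦ 1 ⟧) * ⟦ 2 ⟧      ≡⟨ solve 1 (λ h → (h :- con ⟦ 1 ⟧) :* con ⟦ 2 ⟧ := h :* con ⟦ 2 ⟧ :- con ⟦ 2 ⟧) refl h ⟩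
        h * ⟦ 2 ⟧ - ⟦ 2 ⟧        ≡⟨ cong (_- ⟦ 2 ⟧) h-eq ⟩
        Z + ⟦ 2 ⟧ - ⟦ 2 ⟧        ≡⟨ solve 1 (λ z → z :+ con ⟦ 2 ⟧ :- con ⟦ 2 ⟧ := z) refl Z ⟩
        Z                        ∎)

  module _ {D : ℕ} (D+d≡2x : D ℕ.+ d ≡ 2 ℕ.* x) where

    private
      2X : ⟦ 2 ⟧ * X ≡ ⟦ D ⟧ + Z
      2X = ≡-≐ (ι 2 ⊗ ι x) (ι D ⊕ ι d) (sym D+d≡2x)

    -- Here 2x - d is D, so the square root condition squares to d + 2 ≤ D².
    conjecture-hypothesis : d ℕ.+ 2 ℕ.≤ D ℕ.* D → √ (Z + ⟦ 2 ⟧) ≤ ⟦ 2 ⟧ * X - Z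
    conjecture-hypothesis le = subst (√ (Z + ⟦ 2 ⟧) ≤_) (sym 2X-Z)
      (≤-≐ (ι 0) (ι D) ℕ.z≤n , ≤-≐ (ι d ⊕ ι 2) (ι D ⊗ ι D) le)
      where
      2X-Z : ⟦ 2 ⟧ * X - Z ≡ ⟦ D ⟧
      2X-Z = trans (cong (_- Z) 2X) (solve 2 (λ a c → a :+ c :- c := a) refl ⟦ D ⟧ Z)

    -- The hypothesis gives R_d ≤ - E P_d, so P_{d+1} = Quot P_d + R_d ≤ (Quot - E) P_d, and
    -- `Quot-excess` evaluates the factor.
    excess≤-R/P⇒w-below : ∀ {m} → D ℕ.+ m ≡ s → excess ≤ (- R d X) ÷₀ P d X → w x (suc d) ℕ.≤ suc m ℕ.* w x d
    excess≤-R/P⇒w-below {m} D+m≡s e≤ = ≐-≤ (cast (P-w x (suc d))) ((ι 1 ⊕ ι m) ⊗ cast (P-w x d))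
      (≤-shift (P (suc d) X - excess * P d X) scaled
        (solve 2 (λ a c → a :+ (c :- a) := c) refl (excess * P d X) (P (suc d) X))
        (begin
          - R d X + (P (suc d) X - excess * P d X)
            ≡⟨ solve 4 (λ p′ u p e → :- (p′ :- u :* p) :+ (p′ :- e :* p) := (u :- e) :* p) refl (P (suc d) X) (Quot d X) (P d X) excess ⟩
          (Quot d X - excess) * P d X
            ≡⟨ cong (_* P d X) (trans Quot-excess (cong₂ (λ a c → a - c + Z + ⟦ 1 ⟧) Y≡ 2X)) ⟩
          (⟦ D ⟧ + ⟦ m ⟧ - (⟦ D ⟧ + Z) + Z + ⟦ 1 ⟧) * P d X
            ≡⟨ cong (_* P d X) (solve 3 (λ D m z → D :+ m :- (D :+ z) :+ z :+ con ⟦ 1 ⟧ := con ⟦ 1 ⟧ :+ m) refl ⟦ D ⟧ ⟦ m ⟧ Z) ⟩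
          (⟦ 1 ⟧ + ⟦ m ⟧) * P d X ∎))
      where
      open ≡-Reasoning
      Y≡ : Y ≡ ⟦ D ⟧ + ⟦ m ⟧
      Y≡ = ≡-≐ (ι s) (ι D ⊕ ι m) (sym D+m≡s)
      P>0 : 0ℚ < P d X
      P>0 = <-≐ (ι 0) (cast (P-w x d)) (w>0 x d (ℕ.≤-trans (ℕ.m≤n+m d D) (ℕ.≤-reflexive D+d≡2x)))
      scaled : excess * P d X ≤ - R d X
      scaled = subst (excess * P d X ≤_) (÷₀-* (- R d X) P>0) (*-monoʳ-≤ (ℚ.<⇒≤ P>0) e≤)

    -- Identifying D with the floor plus one.

    module _ (lower : (1 ℕ.+ d) ℕ.* (d ℕ.+ 2 ℕ.+ 2 ℕ.* s) ℕ.< 4 ℕ.* (x ℕ.* x ℕ.+ x)) where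

      private
        3/2 5/2 ½ : ℚ
        ½ = (+ 1) ℚ./ 2
        3/2 = (+ 3) ℚ./ 2
        5/2 = (+ 5) ℚ./ 2

        -- As `Aq` is 4 (x² + x) + (s + 1/2)², subtracting (d + s + 3/2)² leaves `M - N`. Strictness
        -- matters: equality would raise the floor from D - 1 to D.
        below-Aq : (Z + Y + 3/2) * (Z + Y + 3/2) < Aq x s
        below-Aq = <-shift ((Z + Y + 3/2) * (Z + Y + 3/2) - N) (<-≐ N≐ M≐ lower)
          (solve 2 (λ n a → n :+ (a :- n) := a) refl N ((Z + Y + 3/2) * (Z + Y + 3/2)))
          (solve 3 (λ x y z → con ⟦ 4 ⟧ :* (x :* x :+ x) :+ ((z :+ y :+ con 3/2) :* (z :+ y :+ con 3/2) :- (con ⟦ 1 ⟧ :+ z) :* (z :+ con ⟦ 2 ⟧ :+ con ⟦ 2 ⟧ :* y))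
            := con ⟦ 4 ⟧ :* x :* x :+ con ⟦ 4 ⟧ :* x :+ (y :+ con ½) :* (y :+ con ½)) refl X Y Z)

      -- With c = 2x + s + 3/2, the number c - √A lies strictly between D - 1 and D.
      floorK-unique : √ Aq x s < Z + Y + 5/2 → ∀ k → IsFloorK x s k → + D ≡ k ℤ.+ + 1
      floorK-unique (0<a , A<a²) k ((0≤c-k , A≤[c-k]²) , c-k-1<√A) with ℤ.<-cmp (+ D) (k ℤ.+ + 1)
      ... | tri≈ _ D≡k+1 _ = D≡k+1
      -- If D ≤ k, then c - k ≤ d + s + 3/2 < √A, against √A ≤ c - k.
      ... | tri< D<k+1 _ _ = contradiction
        (ℚ.<-≤-trans below-Aq (ℚ.≤-trans A≤[c-k]² (square-mono-≤ 0≤c-k c-k≤))) (ℚ.<-irrefl refl)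
        where
        κ = k ℚ./ 1
        D≤κ : ⟦ D ⟧ ≤ κ
        D≤κ = /1-mono-≤ (+ D) k (subst (+ D ℤ.≤_) (trans (cong ℤ.pred (ℤ.+-comm k (+ 1))) (ℤ.pred-suc k)) (ℤ.i<j⇒i≤pred[j] D<k+1))
        c-k≤ : ⟦ 2 ⟧ * X + Y + 3/2 - κ ≤ Z + Y + 3/2
        c-k≤ = ≤-shift (Z + Y + 3/2 - κ) D≤κ
          (trans (solve 4 (λ D z y k → D :+ (z :+ y :+ con 3/2 :- k) := D :+ z :+ y :+ con 3/2 :- k) refl ⟦ D ⟧ Z Y κ)
            (cong (λ u → u + Y + 3/2 - κ) (sym 2X)))
          (solve 2 (λ k a → k :+ (a :- k) := a) refl κ (Z + Y + 3/2))
      -- If k + 2 ≤ D, then c - k - 1 ≥ d + s + 5/2 > √A, which refutes both alternatives of `<√`.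
      ... | tri> _ _ k+1<D = contradiction c-k-1<√A c-k-1≮√A
        where
        κ = k ℚ./ 1
        κ+2≤D : κ + ⟦ 2 ⟧ ≤ ⟦ D ⟧
        κ+2≤D = subst (_≤ ⟦ D ⟧) (sym (/1-+ k (+ 2))) (/1-mono-≤ (k ℤ.+ + 2) (+ D)
          (subst (ℤ._≤ + D) (trans (ℤ.+-comm (+ 1) (k ℤ.+ + 1)) (ℤ.+-assoc k (+ 1) (+ 1))) (ℤ.i<j⇒suc[i]≤j k+1<D)))
        a≤c-k-1 : Z + Y + 5/2 ≤ ⟦ 2 ⟧ * X + Y + 3/2 - κ - ⟦ 1 ⟧
        a≤c-k-1 = ≤-shift (Z + Y + 3/2 - κ - ⟦ 1 ⟧) κ+2≤D
          (solve 3 (λ z y k → k :+ con ⟦ 2 ⟧ :+ (z :+ y :+ con 3/2 :- k :- con ⟦ 1 ⟧) := z :+ y :+ con 5/2) refl Z Y κ)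
          (trans (solve 4 (λ D z y k → D :+ (z :+ y :+ con 3/2 :- k :- con ⟦ 1 ⟧) := D :+ z :+ y :+ con 3/2 :- k :- con ⟦ 1 ⟧) refl ⟦ D ⟧ Z Y κ)
            (cong (λ u → u + Y + 3/2 - κ - ⟦ 1 ⟧) (sym 2X)))
        c-k-1≮√A : (⟦ 2 ⟧ * X + Y + 3/2 - κ - ⟦ 1 ⟧ <√ Aq x s) → ⊥
        c-k-1≮√A (inj₁ neg) = ℚ.<-irrefl refl (ℚ.<-trans 0<a (ℚ.≤-<-trans a≤c-k-1 neg))
        c-k-1≮√A (inj₂ sq<A) = ℚ.<-irrefl refl (ℚ.<-trans sq<A (ℚ.<-≤-trans A<a² (square-mono-≤ (ℚ.<⇒≤ 0<a) a≤c-k-1)))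

theorem3p2 : Conjecture31 →
    ∀ (s₁ s₂ : ℕ) → 1 ℕ.≤ s₁ → 1 ℕ.≤ s₂ →
    -- s2 > (√(8 s1 + 9) - 1)/2
    √ (⟦ 8 ⟧ * ⟦ s₁ ⟧ + ⟦ 9 ⟧) < ⟦ 2 ⟧ * ⟦ s₂ ⟧ + ⟦ 1 ⟧ →
    ∀ (d₀ : ℕ) → IsD₀ s₁ s₂ (+ d₀) → 5 ℕ.≤ d₀ →
    0ℚ < (⟦ 2 ⟧ ÷₀ ⟦ suc d₀ ⟧) * (⟦ s₁ ⟧ * ⟦ s₁ ⟧ + ⟦ s₁ ⟧) - (⟦ d₀ ⟧ + ⟦ 2 ⟧) ÷₀ ⟦ 2 ⟧ - ⟦ s₂ ⟧ →
    (⟦ 2 ⟧ ÷₀ ⟦ suc d₀ ⟧) * (⟦ s₁ ⟧ * ⟦ s₁ ⟧ + ⟦ s₁ ⟧) - (⟦ d₀ ⟧ + ⟦ 2 ⟧) ÷₀ ⟦ 2 ⟧ - ⟦ s₂ ⟧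
      ≤ c995 * (⟦ d₀ ⟧ - ⟦ 2 ⟧) ÷₀ (⟦ 2 ⟧ * ⟦ s₁ ⟧ + ⟦ d₀ ⟧ - ⟦ 2 ⟧) →
    ∀ (k : ℤ) → IsFloorK s₁ s₂ k →
    Σ ℕ (λ N → ((+ N) ≡ k ℤ.+ + 1) × IsArgMax s₁ s₂ N)
-- Writing d₀ as `suc e` provides the index d₀ - 1 that `argMax` and `w-above` work with.
theorem3p2 conj s₁ s₂ _ _ (_ , s₂-large) (suc e) (_ , √A<) 5≤d₀ 0<E E≤C k floorK =
  D , floorK-unique s₁ s₂ d₀ D+d₀ lower √A< k floorK
    , argMax s₁ s₂ D+m D+d₀
        -- E is at most the conjectured bound, hence at most - R / P at s₁; the conjecture applies
        -- because d₀ + 2 ≤ D².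
        (excess≤-R/P⇒w-below s₁ s₂ d₀ D+d₀ D+m
          (ℚ.≤-trans E≤C (conj d₀ ⟦ s₁ ⟧ 5≤d₀ (conjecture-hypothesis s₁ s₂ d₀ D+d₀
            (ℕ.≤-trans (ℕ.m≤m+n (d₀ ℕ.+ 2) (2 ℕ.* (1 ℕ.+ d₀) ℕ.* m)) (ℕ.<⇒≤ D²>))))))
        -- Here 2 d₀ m ≤ 2 (d₀ + 1) m ≤ D².
        (w-above s₁ D+d₀ (ℕ.≤-trans
          (ℕ.≤-trans (ℕ.*-monoˡ-≤ m (ℕ.*-monoʳ-≤ 2 (ℕ.n≤1+n d₀))) (ℕ.m≤n+m (2 ℕ.* (1 ℕ.+ d₀) ℕ.* m) (d₀ ℕ.+ 2))) (ℕ.<⇒≤ D²>)))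
  where
  d₀ = suc e
  lower : (1 ℕ.+ d₀) ℕ.* (d₀ ℕ.+ 2 ℕ.+ 2 ℕ.* s₂) ℕ.< 4 ℕ.* (s₁ ℕ.* s₁ ℕ.+ s₁)
  lower = excess>0 s₁ s₂ d₀ 0<E
  D = 2 ℕ.* s₁ ∸ d₀
  D+d₀ : D ℕ.+ d₀ ≡ 2 ℕ.* s₁
  D+d₀ = ℕ.m∸n+n≡m (ℕ.<⇒≤ (lower⇒d<2x s₁ s₂ d₀ lower))
  -- The subtraction is exact: E < 1 and the lower bound on s₂ give D ≤ s₂.
  m = s₂ ∸ D
  D+m : D ℕ.+ m ≡ s₂
  D+m = ℕ.m+[n∸m]≡n (D≤s s₁ s₂ d₀ lower D+d₀
    (≐-< (ι 8 ⊗ ι s₁ ⊕ ι 9) ((ι 2 ⊗ ι s₂ ⊕ ι 1) ⊗ (ι 2 ⊗ ι s₂ ⊕ ι 1)) s₂-large)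
    (excess<1 s₁ s₂ d₀ (ℚ.≤-<-trans E≤C (conjecture-bound<1 s₁ d₀ 5≤d₀))))
  D²> : d₀ ℕ.+ 2 ℕ.+ 2 ℕ.* (1 ℕ.+ d₀) ℕ.* m ℕ.< D ℕ.* D
  D²> = D²-lower s₁ s₂ d₀ lower D+d₀ D+m
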